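{- For every finite Abelian group $G$ not isomorphic to $\mathbb{Z}_4$, the lattice $\mathcal{L}(G)$ has a basis of minimal vectors, i.e. $\mathcal{S}(G)$ contains $n$ vectors such that every vector of $\mathcal{L}(G)$ is an integer linear combination of these $n$ vectors.
   Context: Let $G=\{0,g_1,\dots,g_n\}$ be a finite Abelian (additive) group of order $n+1$, with its nonzero elements listed as $g_1,\dots,g_n$. Define $$\mathcal{L}(G)=\Big\{X=(x_1,\dots,x_n,-x_1-\cdots-x_n)\in\mathbb{Z}^{n+1}:\ x_1g_1+\cdots+x_ng_n=0\Big\},$$ a lattice of rank $n$. Let $\|\cdot\|$ be the Euclidean norm, $d(G)=\min\{\|X\|: X\in\mathcal{L}(G)\setminus\{0\}\}$, and $\mathcal{S}(G)=\{X\in\mathcal{L}(G):\|X\|=d(G)\}$ the set of minimal vectors. $\mathbb{Z}_m$ denotes the cyclic group of order $m$. -}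

module Defs where

open import Level using (Level; _⊔_) renaming (suc to lsuc)
open import Algebra.Bundles using (AbelianGroup)
open import Data.Nat as ℕ using (ℕ; zero; suc)
open import Data.Nat.DivMod using (_%_; m%n<n)
open import Data.Fin as Fin using (Fin; toℕ; fromℕ; fromℕ<; inject₁)
open import Data.Integer as ℤ using (ℤ; +_; -[1+_])
open import Data.Product using (Σ; ∃; ∃-syntax; _×_; _,_)
open import Relation.Nullary using (¬_)
open import Relation.Binary.PropositionalEquality using (_≡_)

sumℤ : ∀ n → (Fin n → ℤ) → ℤ
sumℤ zero    f = + 0
sumℤ (suc n) f = f Fin.zero ℤ.+ sumℤ n (λ i → f (Fin.suc i))

-- A finite Abelian group G of order n+1, with its nonzero elements listed
-- (without repetition) as g 0, …, g (n-1)  (the paper's g₁,…,gₙ).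
record FinAbGroup (c ℓ : Level) : Set (lsuc (c ⊔ ℓ)) where
  field
    grp : AbelianGroup c ℓ
  open AbelianGroup grp public
  field
    n            : ℕ
    g            : Fin n → Carrier
    g-nonzero    : ∀ i → ¬ (g i ≈ ε)
    g-injective  : ∀ i j → g i ≈ g j → i ≡ j
    g-surjective : ∀ x → ¬ (x ≈ ε) → ∃[ i ] (g i ≈ x)

  _·ℕ_ : ℕ → Carrier → Carrier
  zero  ·ℕ x = ε
  suc k ·ℕ x = x ∙ (k ·ℕ x)

  _·_ : ℤ → Carrier → Carrier
  (+ k)      · x = k ·ℕ x
  -[1+ k ]   · x = (suc k ·ℕ x) ⁻¹

  gsum : ∀ m → (Fin m → Carrier) → Carrier
  gsum zero    f = ε
  gsum (suc m) f = f Fin.zero ∙ gsum m (λ i → f (Fin.suc i))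

open FinAbGroup

Vecℤ : ℕ → Set
Vecℤ n = Fin (suc n) → ℤ

InL : ∀ {c ℓ} (G : FinAbGroup c ℓ) → Vecℤ (n G) → Set ℓ
InL G X =
  (X (fromℕ (n G)) ≡ ℤ.- sumℤ (n G) (λ i → X (inject₁ i)))
  × (_≈_ G (gsum G (n G) (λ i → _·_ G (X (inject₁ i)) (g G i))) (ε G))

normSq : ∀ m → Vecℤ m → ℤ
normSq m X = sumℤ (suc m) (λ i → X i ℤ.* X i)

IsZero : ∀ m → Vecℤ m → Set
IsZero m X = ∀ i → X i ≡ + 0

-- X ∈ 𝓢(G): X is a nonzero lattice vector of minimal norm d(G)
-- (comparing squared norms, equivalent since norms are nonnegative).
InS : ∀ {c ℓ} (G : FinAbGroup c ℓ) → Vecℤ (n G) → Set ℓ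
InS G X =
  InL G X × ¬ IsZero (n G) X
  × (∀ Y → InL G Y → ¬ IsZero (n G) Y → normSq (n G) X ℤ.≤ normSq (n G) Y)

lincomb : ∀ m k → (Fin k → ℤ) → (Fin k → Vecℤ m) → Vecℤ m
lincomb m k c v i = sumℤ k (λ j → c j ℤ.* v j i)

HasMinimalBasis : ∀ {c ℓ} (G : FinAbGroup c ℓ) → Set ℓ
HasMinimalBasis G =
  Σ (Fin (n G) → Vecℤ (n G)) λ v →
    (∀ j → InS G (v j))
    × (∀ X → InL G X → ∃[ c ] (∀ i → X i ≡ lincomb (n G) (n G) c v i))

_+₄_ : Fin 4 → Fin 4 → Fin 4
a +₄ b = fromℕ< (m%n<n (toℕ a ℕ.+ toℕ b) 4)

IsoZ4 : ∀ {c ℓ} (G : FinAbGroup c ℓ) → Set (c ⊔ ℓ)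
IsoZ4 G =
  Σ (Fin 4 → Carrier G) λ f →
    (∀ a b → _≈_ G (f (a +₄ b)) (_∙_ G (f a) (f b)))
    × (∀ a b → _≈_ G (f a) (f b) → a ≡ b)
    × (∀ x → ∃[ a ] (_≈_ G (f a) x))

{-# OPTIONS --safe #-}
module Submission where

-- 𝓛(G) is spanned by integer vectors v₁, …, vₙ exactly when φ(g) = e_g − e₀ is an additive map
-- from G to ℤ^G / ⟨v₁, …, vₙ⟩, because modulo the span a vector of coordinate sum 0 then equals
-- φ of its value in G. Relations p + q = r + s between four distinct elements give vectors
-- e_p + e_q − e_r − e_s of squared norm 4, which is minimal: norms in 𝓛(G) are even, and 2 would
-- force two elements of G to coincide. So it suffices to find n such relations that make every φ
-- killing them additive. They are found along a chain of subgroups: if H has |H| − 1 relations,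
-- a ∉ H and k is least with k a ∈ H, choose b ∈ H with b ≠ 0, b ≠ k a, and add
--   (h + a) + 0 = a + h                                  for h ∈ H, h ≠ 0,
--   (h + j a) + (h + b) = (h + b + (j − 1) a) + (h + a)  for h ∈ H, 2 ≤ j < k, and for h = 0, j = k,
-- which gives φ(h + j a) = φ(h) + j φ(a) and φ(k a) = k φ(a). The chain starts with a cyclic group
-- of order at least 5, with ℤ₂ × ℤ₂, or with ℤ₃ × ℤ₃; a group of order at least 4 that contains
-- none of these is ℤ₄. Orders 2 and 3, with minimal squared norms 8 and 6, are done by hand.

open import Defs
open import Level using (Level; 0ℓ)
open import Algebra.Bundles using (AbelianGroup)
open import Algebra.Structures using (IsAbelianGroup)
open import Data.Fin as Fin using (Fin; zero; suc; toℕ; inject₁; fromℕ)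
import Data.Fin.Properties as Finₚ
import Data.Fin.Relation.Unary.Top as Top
open import Data.Integer as ℤ using (ℤ; +_; -[1+_])
import Data.Integer.Properties as ℤₚ
import Data.Integer.Solver
open import Data.List using (List; []; _∷_; _++_; map; length; lookup; cartesianProduct; applyUpTo)
import Data.List.Properties as Listₚ
open import Data.List.Membership.DecPropositional using (_∈?_)
open import Data.List.Membership.Propositional using (_∈_; _∉_)
open import Data.List.Membership.Propositional.Properties
open import Data.List.Relation.Unary.All as All using (All; []; _∷_)
import Data.List.Relation.Unary.All.Properties as Allₚ
open import Data.List.Relation.Unary.AllPairs using ([]; _∷_)
open import Data.List.Relation.Unary.Any using (here; there; index)
import Data.List.Relation.Unary.Any.Properties as Anyₚ
open import Data.List.Relation.Unary.Unique.Propositional using (Unique)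
import Data.List.Relation.Unary.Unique.Propositional.Properties as Uniqueₚ
open import Data.Nat as ℕ using (ℕ; zero; suc; z≤n; s≤s)
open import Data.Nat.DivMod using (_%_; _/_; m%n<n; m≡m%n+[m/n]*n)
import Data.Nat.Properties as ℕₚ
open import Data.Product using (Σ; ∃₂; ∃-syntax; _×_; _,_; proj₁; proj₂)
open import Data.Sum using (_⊎_; inj₁; inj₂)
open import Data.Vec as Vec using (Vec; []; _∷_; zipWith; replicate)
open import Function using (_∘_)
open import Relation.Binary using (tri<; tri≈; tri>)
open import Relation.Binary.PropositionalEquality as ≡ using (_≡_; _≢_)
open import Relation.Nullary using (¬_; Dec; yes; no; contradiction)
open import Relation.Nullary.Decidable using (¬?; decidable-stable; _×-dec_)

-- Only a count and a spanning statement have to be proved: n vectors that span a lattice of rank n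
-- form a basis, so linear independence and determinants never appear. The count is right because
-- adjoining `a` to a subgroup H adds (k - 1)|H| elements and as many relations: |H| - 1 of the
-- first kind, (k - 2)|H| of the second, and one more of the second kind for the value at k a.
--
-- The first obstacle is the start. Cyclic groups of order 2 and 3 have no relation between four
-- distinct elements, and ℤ₄ has only two, 0 + 1 = 2 + 3 and 0 + 3 = 1 + 2, where three would be
-- needed. In ℤ₂ × ℤ₂ and ℤ₃ × ℤ₃ the additivity on the first factor therefore has to be extracted
-- from relations that use a coset of it.
--
-- The second obstacle is constructive. Equality in G need not be decidable, and `g-surjective`
-- yields an index only for an element already known to be nonzero. The group theory is therefore
-- carried out on the indices, a finite type with decidable equality; G itself returns when vectors
-- are evaluated and when ℤ₄ is recognised.

private module ℤSolver = Data.Integer.Solver.+-*-Solver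

-- Integer multiples and an equation solver for abelian groups.

module IntegerMultiples {c ℓ} (M : AbelianGroup c ℓ) where
  open AbelianGroup M
  open import Algebra.Properties.AbelianGroup M
  open import Algebra.Properties.Monoid.Mult monoid public
    using () renaming (_×_ to _×ℕ_; ×-homo-+ to ×ℕ-homo-+; ×-assocˡ to ×ℕ-assoc)
  open import Algebra.Properties.CommutativeSemigroup commutativeSemigroup
    using (interchange) public
  open import Relation.Binary.Reasoning.Setoid setoid

  infixr 8 _⊙_
  _⊙_ : ℤ → Carrier → Carrier
  (+ k)      ⊙ x = k ×ℕ x
  (-[1+ k ]) ⊙ x = (suc k ×ℕ x) ⁻¹

  ⁻¹-homo-∙ : ∀ x y → (x ∙ y) ⁻¹ ≈ x ⁻¹ ∙ y ⁻¹
  ⁻¹-homo-∙ x y = sym (⁻¹-∙-comm x y)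

  ⊖-⊙ : ∀ x m n → (m ℤ.⊖ n) ⊙ x ≈ m ×ℕ x ∙ (n ×ℕ x) ⁻¹
  ⊖-⊙ x zero    zero    = sym (inverseʳ ε)
  ⊖-⊙ x (suc m) zero    = sym (trans (∙-congˡ ε⁻¹≈ε) (identityʳ _))
  ⊖-⊙ x zero    (suc n) = sym (identityˡ _)
  ⊖-⊙ x (suc m) (suc n) = begin
    (suc m ℤ.⊖ suc n) ⊙ x                  ≡⟨ ≡.cong (_⊙ x) (ℤₚ.[1+m]⊖[1+n]≡m⊖n m n) ⟩
    (m ℤ.⊖ n) ⊙ x                          ≈⟨ ⊖-⊙ x m n ⟩
    m ×ℕ x ∙ (n ×ℕ x) ⁻¹                   ≈⟨ identityˡ _ ⟨
    ε ∙ (m ×ℕ x ∙ (n ×ℕ x) ⁻¹)             ≈⟨ ∙-congʳ (inverseʳ x) ⟨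
    (x ∙ x ⁻¹) ∙ (m ×ℕ x ∙ (n ×ℕ x) ⁻¹)    ≈⟨ interchange _ _ _ _ ⟩
    (x ∙ m ×ℕ x) ∙ (x ⁻¹ ∙ (n ×ℕ x) ⁻¹)    ≈⟨ ∙-congˡ (⁻¹-∙-comm _ _) ⟩
    suc m ×ℕ x ∙ (suc n ×ℕ x) ⁻¹           ∎

  ⊙-homo-+ : ∀ x i j → (i ℤ.+ j) ⊙ x ≈ i ⊙ x ∙ j ⊙ x
  ⊙-homo-+ x (+ m)      (+ n)      = ×ℕ-homo-+ x m n
  ⊙-homo-+ x (+ m)      (-[1+ n ]) = ⊖-⊙ x m (suc n)
  ⊙-homo-+ x (-[1+ m ]) (+ n)      = trans (⊖-⊙ x n (suc m)) (comm _ _)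
  ⊙-homo-+ x (-[1+ m ]) (-[1+ n ]) = begin
    (suc (suc (m ℕ.+ n)) ×ℕ x) ⁻¹          ≡⟨ ≡.cong (λ k → (k ×ℕ x) ⁻¹) (≡.cong suc (ℕₚ.+-suc m n)) ⟨
    ((suc m ℕ.+ suc n) ×ℕ x) ⁻¹            ≈⟨ ⁻¹-cong (×ℕ-homo-+ x (suc m) (suc n)) ⟩
    (suc m ×ℕ x ∙ suc n ×ℕ x) ⁻¹           ≈⟨ ⁻¹-homo-∙ _ _ ⟩
    (suc m ×ℕ x) ⁻¹ ∙ (suc n ×ℕ x) ⁻¹      ∎

  ⊙-homo-neg : ∀ x i → (ℤ.- i) ⊙ x ≈ (i ⊙ x) ⁻¹
  ⊙-homo-neg x (+ zero)   = sym ε⁻¹≈ε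
  ⊙-homo-neg x (+ suc n)  = refl
  ⊙-homo-neg x (-[1+ n ]) = sym (⁻¹-involutive _)

module AbelianGroupSolver {c ℓ} (M : AbelianGroup c ℓ) where
  open AbelianGroup M
  open import Algebra.Properties.AbelianGroup M
  open IntegerMultiples M
  open import Relation.Binary.Reasoning.Setoid setoid

  infixl 6 _:+_
  infix 7 :-_
  data Expr (n : ℕ) : Set where
    var  : Fin n → Expr n
    :0   : Expr n
    _:+_ : Expr n → Expr n → Expr n
    :-_  : Expr n → Expr n

  ⟦_⟧ : ∀ {n} → Expr n → Vec Carrier n → Carrier
  ⟦ var i  ⟧ ρ = Vec.lookup ρ i
  ⟦ :0     ⟧ ρ = ε
  ⟦ e :+ f ⟧ ρ = ⟦ e ⟧ ρ ∙ ⟦ f ⟧ ρ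
  ⟦ :- e   ⟧ ρ = ⟦ e ⟧ ρ ⁻¹

  unit : ∀ {n} → Fin n → Vec ℤ n
  unit zero    = + 1 ∷ replicate _ (+ 0)
  unit (suc i) = + 0 ∷ unit i

  -- The normal form is the vector of integer coefficients. For concrete expressions two equal
  -- normal forms are the same closed term, so `refl` proves the equation in any abelian group,
  -- including quotients whose equality is not decidable.
  normalise : ∀ {n} → Expr n → Vec ℤ n
  normalise (var i)  = unit i
  normalise :0       = replicate _ (+ 0)
  normalise (e :+ f) = zipWith ℤ._+_ (normalise e) (normalise f)
  normalise (:- e)   = Vec.map ℤ.-_ (normalise e)

  eval : ∀ {n} → Vec ℤ n → Vec Carrier n → Carrier
  eval []       []      = ε
  eval (k ∷ ks) (x ∷ ρ) = k ⊙ x ∙ eval ks ρ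

  eval-zero : ∀ {n} (ρ : Vec Carrier n) → eval (replicate _ (+ 0)) ρ ≈ ε
  eval-zero []      = refl
  eval-zero (x ∷ ρ) = trans (identityˡ _) (eval-zero ρ)

  eval-unit : ∀ {n} (i : Fin n) ρ → eval (unit i) ρ ≈ Vec.lookup ρ i
  eval-unit zero    (x ∷ ρ) = trans (∙-cong (identityʳ x) (eval-zero ρ)) (identityʳ x)
  eval-unit (suc i) (x ∷ ρ) = trans (identityˡ _) (eval-unit i ρ)

  eval-+ : ∀ {n} (ks ls : Vec ℤ n) ρ → eval (zipWith ℤ._+_ ks ls) ρ ≈ eval ks ρ ∙ eval ls ρ
  eval-+ []       []       []      = sym (identityˡ ε)
  eval-+ (k ∷ ks) (l ∷ ls) (x ∷ ρ) =
    trans (∙-cong (⊙-homo-+ x k l) (eval-+ ks ls ρ)) (interchange _ _ _ _)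

  eval-neg : ∀ {n} (ks : Vec ℤ n) ρ → eval (Vec.map ℤ.-_ ks) ρ ≈ eval ks ρ ⁻¹
  eval-neg []       []      = sym ε⁻¹≈ε
  eval-neg (k ∷ ks) (x ∷ ρ) =
    trans (∙-cong (⊙-homo-neg x k) (eval-neg ks ρ)) (⁻¹-∙-comm _ _)

  ⟦_⟧⇓ : ∀ {n} → Expr n → Vec Carrier n → Carrier
  ⟦ e ⟧⇓ ρ = eval (normalise e) ρ

  correct : ∀ {n} (e : Expr n) ρ → ⟦ e ⟧⇓ ρ ≈ ⟦ e ⟧ ρ
  correct (var i)  ρ = eval-unit i ρ
  correct :0       ρ = eval-zero ρ
  correct (e :+ f) ρ =
    trans (eval-+ (normalise e) (normalise f) ρ) (∙-cong (correct e ρ) (correct f ρ))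
  correct (:- e)   ρ = trans (eval-neg (normalise e) ρ) (⁻¹-cong (correct e ρ))

  open import Relation.Binary.Reflection setoid var ⟦_⟧ ⟦_⟧⇓ correct public
    using (solve; _⊜_)

  -- The second premise is x − y = p − q without subtraction, so that the solver can supply it.
  combine : ∀ {x y p q} → p ≈ q → x ∙ q ≈ y ∙ p → x ≈ y
  combine {p = p} p≈q h = ∙-cancelʳ _ _ _ (trans h (∙-congˡ p≈q))

-- Lists without repetition and bounded search.

module _ {ℓ} {A : Set ℓ} where

  lookup-unique-injective : ∀ {xs : List A} → Unique xs →
                            ∀ i j → lookup xs i ≡ lookup xs j → i ≡ j
  lookup-unique-injective (_ ∷ _)   zero    zero    _  = ≡.refl
  lookup-unique-injective (x∉ ∷ _)  zero    (suc j) eq = contradiction eq (All.lookup x∉ (∈-lookup j))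
  lookup-unique-injective (x∉ ∷ _)  (suc i) zero    eq = contradiction (≡.sym eq) (All.lookup x∉ (∈-lookup i))
  lookup-unique-injective (_ ∷ uxs) (suc i) (suc j) eq = ≡.cong suc (lookup-unique-injective uxs i j eq)

  -- Sending a position of `xs` to a position of the same element in `ys` is injective.
  unique-⊆⇒length-≤ : ∀ {xs ys : List A} → Unique xs → (∀ {x} → x ∈ xs → x ∈ ys) →
                      length xs ℕ.≤ length ys
  unique-⊆⇒length-≤ {xs} {ys} uxs xs⊆ys = Finₚ.injective⇒≤ {f = f} λ {i} {j} eq →
    lookup-unique-injective uxs i j
      (≡.trans (Anyₚ.lookup-index (xs⊆ys (∈-lookup i)))
        (≡.trans (≡.cong (lookup ys) eq) (≡.sym (Anyₚ.lookup-index (xs⊆ys (∈-lookup j))))))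
    where
    f : Fin (length xs) → Fin (length ys)
    f i = index (xs⊆ys (∈-lookup i))

-- Injectivity is asked only on members of the list, because `point` below is injective only for
-- multiples smaller than the relative order.
unique-map-on : ∀ {a b} {A : Set a} {B : Set b} (f : A → B) {xs : List A} →
                (∀ {x y} → x ∈ xs → y ∈ xs → f x ≡ f y → x ≡ y) → Unique xs → Unique (map f xs)
unique-map-on f inj []          = []
unique-map-on f inj (x∉ ∷ uxs) =
  Allₚ.map⁺ (All.tabulate λ y∈ eq → All.lookup x∉ y∈ (inj (here ≡.refl) (there y∈) eq))
  ∷ unique-map-on f (λ x∈ y∈ → inj (there x∈) (there y∈)) uxs

∃-outside : ∀ {N} {xs ys : List (Fin N)} → Unique xs → length ys ℕ.< length xs →
            ∃[ x ] x ∈ xs × x ∉ ys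
∃-outside {xs = xs} {ys} uxs lt with Finₚ.any? (λ x → _∈?_ Finₚ._≟_ x xs ×-dec ¬? (_∈?_ Finₚ._≟_ x ys))
... | yes found = found
... | no ¬found = contradiction lt (ℕₚ.≤⇒≯ (unique-⊆⇒length-≤ uxs λ {x} x∈ →
        decidable-stable (_∈?_ Finₚ._≟_ x ys) λ x∉ → ¬found (x , x∈ , x∉)))

least : ∀ {p} {P : ℕ → Set p} → (∀ k → Dec (P k)) → ∀ m → P m →
        ∃[ k ] P k × (∀ {j} → j ℕ.< k → ¬ P j)
least         P? zero    pm = zero , pm , λ ()
least {P = P} P? (suc m) pm with P? 0
... | yes p0 = zero , p0 , λ ()
... | no ¬p0 with least {P = P ∘ suc} (P? ∘ suc) m pm
...   | k , pk , below = suc k , pk , λ { {zero} _ → ¬p0 ; {suc j} (s≤s lt) → below lt }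

-- Finite abelian groups on `Fin N`: subgroups and relative orders.

module FiniteGroup {N : ℕ} (_+_ : Fin N → Fin N → Fin N) (0# : Fin N) (-_ : Fin N → Fin N)
                   (isAbelianGroup : IsAbelianGroup _≡_ _+_ 0# -_) where

  open import Data.Nat using (_<_; _≤_; _∸_)

  A : Set
  A = Fin N

  𝔸 : AbelianGroup 0ℓ 0ℓ
  𝔸 = record { isAbelianGroup = isAbelianGroup }

  open AbelianGroup 𝔸 public
    using (identityˡ; identityʳ; inverseˡ; inverseʳ; assoc; comm)
  open import Algebra.Properties.AbelianGroup 𝔸 using (∙-cancelˡ; ∙-cancelʳ)
  open IntegerMultiples 𝔸 public
    using () renaming (_×ℕ_ to _*_; ×ℕ-homo-+ to *-homo-+; ×ℕ-assoc to *-assoc)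
  module SA = AbelianGroupSolver 𝔸
  open SA using (var; :0; _:+_; :-_; _⊜_)

  infixl 6 _-′_
  _-′_ : ∀ {n} → SA.Expr n → SA.Expr n → SA.Expr n
  x -′ y = x :+ (:- y)

  _∈A?_ : (x : A) (xs : List A) → Dec (x ∈ xs)
  _∈A?_ = _∈?_ Finₚ._≟_

  -- Two of the N + 1 multiples 0 x, ..., N x coincide, and cancelling the smaller one leaves a
  -- positive multiple equal to zero.
  finite-order : ∀ x → ∃[ m ] suc m * x ≡ 0#
  finite-order x with Finₚ.pigeonhole (ℕₚ.n<1+n N) (λ i → toℕ i * x)
  ... | i , j , i<j , eq = d , ∙-cancelˡ (toℕ i * x) _ _ (≡.trans
          (≡.trans (≡.sym (*-homo-+ x (toℕ i) (suc d))) (≡.cong (_* x) i+d≡j))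
          (≡.trans (≡.sym eq) (≡.sym (identityʳ _))))
    where
    d = toℕ j ∸ suc (toℕ i)
    i+d≡j : toℕ i ℕ.+ suc d ≡ toℕ j
    i+d≡j = ≡.trans (ℕₚ.+-suc (toℕ i) d) (ℕₚ.m+[n∸m]≡n i<j)

  record Submonoid (D : List A) : Set where
    field
      unique : Unique D
      0∈     : 0# ∈ D
      +∈     : ∀ {x y} → x ∈ D → y ∈ D → (x + y) ∈ D

    *∈ : ∀ m {x} → x ∈ D → m * x ∈ D
    *∈ zero    x∈ = 0∈
    *∈ (suc m) x∈ = +∈ x∈ (*∈ m x∈)

    -- If (m + 1) x = 0 then -x = m x, so in a finite group closure under sums gives inverses.
    -∈ : ∀ {x} → x ∈ D → (- x) ∈ D
    -∈ {x} x∈ with finite-order x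
    ... | m , eq = ≡.subst (_∈ D)
          (SA.combine eq (SA.solve 2 (λ x y → y :+ :0 ⊜ (:- x) :+ (x :+ y)) ≡.refl x (m * x)))
          (*∈ m x∈)

    diff∈ : ∀ {x y} → x ∈ D → y ∈ D → (x + (- y)) ∈ D
    diff∈ x∈ y∈ = +∈ x∈ (-∈ y∈)

  module _ (M : AbelianGroup 0ℓ 0ℓ) (φ : A → AbelianGroup.Carrier M) where
    open AbelianGroup M
    open IntegerMultiples M using (_×ℕ_)

    AdditiveOn : List A → Set
    AdditiveOn D = ∀ {g h} → g ∈ D → h ∈ D → φ (g + h) ≈ φ g ∙ φ h

    Pointed : Set
    Pointed = φ 0# ≈ ε

    TranslatesBy : A → List A → Set
    TranslatesBy a D = ∀ {h} → h ∈ D → φ (h + a) ≈ φ h ∙ φ a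

    MultiplicativeBelow : ℕ → A → Set
    MultiplicativeBelow k a = ∀ {j} → j < k → φ (j * a) ≈ j ×ℕ φ a

    Annihilates : ℕ → A → Set
    Annihilates k a = k ×ℕ φ a ≈ ε

  trivial : Submonoid (0# ∷ [])
  trivial = record
    { unique = [] ∷ []
    ; 0∈     = here ≡.refl
    ; +∈     = λ { (here ≡.refl) (here ≡.refl) → here (identityˡ 0#) } }

  -- The order of the class of `a` in the quotient by `D`; over the trivial subgroup it is the
  -- ordinary order of `a`.
  record IsRelativeOrder (D : List A) (a : A) (k : ℕ) : Set where
    field
      positive : 0 < k
      ka∈      : k * a ∈ D
      minimal  : ∀ {j} → 0 < j → j < k → j * a ∉ D

  relativeOrder : ∀ {D} → Submonoid D → ∀ a → ∃[ k ] IsRelativeOrder D a k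
  relativeOrder {D} S a with finite-order a
  -- The search runs over k with (k + 1) a ∈ D, so the number found is positive from the outset.
  ... | m , eq with least {P = λ k → suc k * a ∈ D} (λ k → (suc k * a) ∈A? D) m (≡.subst (_∈ D) (≡.sym eq) (Submonoid.0∈ S))
  ...   | k , ka∈ , below = suc k , record
            { positive = s≤s z≤n ; ka∈ = ka∈ ; minimal = λ { {suc j} _ (s≤s lt) → below lt } }

  -- Adjoining one element to a subgroup.

  module Extension {D : List A} (S : Submonoid D) (a : A) {k : ℕ} (O : IsRelativeOrder D a k) where
    open Submonoid S
    open IsRelativeOrder O

    point : A × ℕ → A
    point (h , j) = h + (j * a)

    -- The levels run over 1, ..., k - 1, since level 0 is `D` itself. The cells thus count the
    -- elements that are added, and later they also index the relations that are added.
    grid : List (A × ℕ)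
    grid = cartesianProduct D (applyUpTo suc (k ∸ 1))

    D⁺ : List A
    D⁺ = D ++ map point grid

    k≡ : suc (k ∸ 1) ≡ k
    k≡ = ℕₚ.m+[n∸m]≡n positive

    ∈grid⁻ : ∀ {h j} → (h , j) ∈ grid → h ∈ D × 0 < j × j < k
    ∈grid⁻ hj∈ with ∈-cartesianProduct⁻ D _ hj∈
    ... | h∈ , j∈ with ∈-applyUpTo⁻ suc j∈
    ...   | i , i< , ≡.refl = h∈ , s≤s z≤n , ≡.subst (suc i <_) k≡ (s≤s i<)

    ∈grid⁺ : ∀ {h j} → h ∈ D → 0 < j → j < k → (h , j) ∈ grid
    ∈grid⁺ {j = suc j} h∈ _ j<k =
      ∈-cartesianProduct⁺ h∈ (∈-applyUpTo⁺ suc (ℕₚ.≤-pred (≡.subst (suc j <_) (≡.sym k≡) j<k)))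

    point∈ : ∀ {h j} → h ∈ D → j < k → point (h , j) ∈ D⁺
    point∈ {h} {zero}  h∈ _   = ∈-++⁺ˡ (≡.subst (_∈ D) (≡.sym (identityʳ h)) h∈)
    point∈ {h} {suc j} h∈ j<k = ∈-++⁺ʳ D (∈-map⁺ point (∈grid⁺ h∈ (s≤s z≤n) j<k))

    ∈D⁺⁻ : ∀ {g} → g ∈ D⁺ → ∃₂ λ h j → h ∈ D × j < k × g ≡ point (h , j)
    ∈D⁺⁻ {g} g∈ with ∈-++⁻ D g∈
    ... | inj₁ g∈D = g , 0 , g∈D , positive , ≡.sym (identityʳ g)
    ... | inj₂ g∈′ with ∈-map⁻ point g∈′
    ...   | (h , j) , hj∈ , eq with ∈grid⁻ hj∈
    ...     | h∈ , _ , j<k = h , j , h∈ , j<k , eq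

    -- Otherwise (j - i) a = h - h′ would lie in `D` at a positive level below `k`.
    level-≮ : ∀ {h h′ i j} → h ∈ D → h′ ∈ D → j < k → point (h , i) ≡ point (h′ , j) → ¬ i < j
    level-≮ {h} {h′} {i} {j} h∈ h′∈ j<k eq i<j =
      minimal (ℕₚ.m<n⇒0<n∸m i<j) (ℕₚ.≤-<-trans (ℕₚ.m∸n≤m j i) j<k) (≡.subst (_∈ D) (≡.sym d≡) (diff∈ h∈ h′∈))
      where
      d≡ : (j ∸ i) * a ≡ h + (- h′)
      d≡ = SA.combine (≡.trans (≡.cong (λ x → h′ + x) (≡.trans (≡.sym (*-homo-+ a i (j ∸ i))) (≡.cong (_* a) (ℕₚ.m+[n∸m]≡n (ℕₚ.<⇒≤ i<j))))) (≡.sym eq))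
            (SA.solve 4 (λ h h′ x d → d :+ (h :+ x) ⊜ (h -′ h′) :+ (h′ :+ (x :+ d))) ≡.refl h h′ (i * a) ((j ∸ i) * a))

    point-injective : ∀ {h h′ i j} → h ∈ D → h′ ∈ D → i < k → j < k →
                      point (h , i) ≡ point (h′ , j) → (h , i) ≡ (h′ , j)
    point-injective {h} {h′} {i} {j} h∈ h′∈ i<k j<k eq with ℕₚ.<-cmp i j
    ... | tri< i<j _ _    = contradiction i<j (level-≮ h∈ h′∈ j<k eq)
    ... | tri> _ _ j<i    = contradiction j<i (level-≮ h′∈ h∈ i<k (≡.sym eq))
    ... | tri≈ _ ≡.refl _ = ≡.cong (_, i) (∙-cancelʳ _ _ _ eq)

    -- For i, j < k the sum is below 2k, so at most one `k` is carried; k a ∈ D absorbs the carry.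
    wrap : ∀ {i j} → i < k → j < k → i ℕ.+ j < k ⊎ ∃[ r ] r < k × i ℕ.+ j ≡ k ℕ.+ r
    wrap {i} {j} i<k j<k with ℕₚ.<-≤-connex (i ℕ.+ j) k
    ... | inj₁ lt = inj₁ lt
    ... | inj₂ ge = inj₂ ((i ℕ.+ j) ∸ k , r<k , ≡.sym (ℕₚ.m+[n∸m]≡n ge))
      where
      r<k : (i ℕ.+ j) ∸ k < k
      r<k = ℕₚ.+-cancelˡ-< k _ _ (≡.subst (_< k ℕ.+ k) (≡.sym (ℕₚ.m+[n∸m]≡n ge)) (ℕₚ.+-mono-< i<k j<k))

    point-+ : ∀ h h′ i j → point (h , i) + point (h′ , j) ≡ point (h + h′ , i ℕ.+ j)
    point-+ h h′ i j = ≡.trans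
      (SA.solve 4 (λ h h′ x y → (h :+ x) :+ (h′ :+ y) ⊜ (h :+ h′) :+ (x :+ y)) ≡.refl h h′ (i * a) (j * a))
      (≡.cong (λ x → (h + h′) + x) (≡.sym (*-homo-+ a i j)))

    point-wrap : ∀ h h′ i j r → i ℕ.+ j ≡ k ℕ.+ r →
                 point (h , i) + point (h′ , j) ≡ point ((h + h′) + (k * a) , r)
    point-wrap h h′ i j r eq = ≡.trans (point-+ h h′ i j)
      (≡.trans (≡.cong (λ x → (h + h′) + x) (≡.trans (≡.cong (_* a) eq) (*-homo-+ a k r))) (≡.sym (assoc _ _ _)))

    submonoid : Submonoid D⁺
    submonoid = record
      { unique = Uniqueₚ.++⁺ unique
          (unique-map-on point
            (λ x∈ y∈ → let h∈ , _ , i<k = ∈grid⁻ x∈ ; h′∈ , _ , j<k = ∈grid⁻ y∈ in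
                       point-injective h∈ h′∈ i<k j<k)
            (Uniqueₚ.cartesianProduct⁺ unique
              (Uniqueₚ.applyUpTo⁺₁ suc _ λ i<j _ eq → ℕₚ.<⇒≢ i<j (ℕₚ.suc-injective eq))))
          disjoint
      ; 0∈ = ∈-++⁺ˡ 0∈
      ; +∈ = closed }
      where
      -- An element of `D` is its own point at level 0, so meeting a point of positive level
      -- contradicts `level-≮`.
      disjoint : ∀ {v} → ¬ (v ∈ D × v ∈ map point grid)
      disjoint (v∈D , v∈) with ∈-map⁻ point v∈
      ... | (h , j) , hj∈ , eq with ∈grid⁻ hj∈
      ...   | h∈ , 0<j , j<k = level-≮ v∈D h∈ j<k (≡.trans (identityʳ _) eq) 0<j

      closed : ∀ {x y} → x ∈ D⁺ → y ∈ D⁺ → (x + y) ∈ D⁺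
      closed x∈ y∈ with ∈D⁺⁻ x∈ | ∈D⁺⁻ y∈
      ... | h , i , h∈ , i<k , ≡.refl | h′ , j , h′∈ , j<k , ≡.refl with wrap i<k j<k
      ...   | inj₁ i+j<k = ≡.subst (_∈ D⁺) (≡.sym (point-+ h h′ i j)) (point∈ (+∈ h∈ h′∈) i+j<k)
      ...   | inj₂ (r , r<k , i+j≡k+r) =
              ≡.subst (_∈ D⁺) (≡.sym (point-wrap h h′ i j r i+j≡k+r)) (point∈ (+∈ (+∈ h∈ h′∈) ka∈) r<k)

    module _ (M : AbelianGroup 0ℓ 0ℓ) (φ : A → AbelianGroup.Carrier M) where
      open AbelianGroup M using (_≈_; _∙_; refl; trans; sym; reflexive; ∙-cong; ∙-congˡ; ∙-congʳ)
      open IntegerMultiples M using (_×ℕ_; ×ℕ-homo-+)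
      private module SM = AbelianGroupSolver M

      -- Without a carry, additivity holds levelwise. With a carry, the sum is (h + h′ + k a) + r a;
      -- here k a belongs to `D`, where φ is additive, and the last hypothesis turns φ(k a) back
      -- into k copies of φ(a).
      glue : AdditiveOn M φ D →
             (∀ {h j} → h ∈ D → j < k → φ (point (h , j)) ≈ φ h ∙ j ×ℕ φ a) →
             φ (k * a) ≈ k ×ℕ φ a →
             AdditiveOn M φ D⁺
      glue add lin top x∈ y∈ with ∈D⁺⁻ x∈ | ∈D⁺⁻ y∈
      ... | h , i , h∈ , i<k , ≡.refl | h′ , j , h′∈ , j<k , ≡.refl with wrap i<k j<k
      ...   | inj₁ i+j<k =
        trans (trans (reflexive (≡.cong φ (point-+ h h′ i j)))
                     (trans (lin (+∈ h∈ h′∈) i+j<k) (∙-cong (add h∈ h′∈) (×ℕ-homo-+ (φ a) i j))))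
              (trans (SM.solve 4 (λ h h′ x y → (h SM.:+ h′) SM.:+ (x SM.:+ y) ⊜ᴹ (h SM.:+ x) SM.:+ (h′ SM.:+ y))
                        refl (φ h) (φ h′) (i ×ℕ φ a) (j ×ℕ φ a))
                     (sym (∙-cong (lin h∈ i<k) (lin h′∈ j<k))))
        where open SM using () renaming (_⊜_ to _⊜ᴹ_)
      ...   | inj₂ (r , r<k , i+j≡k+r) =
        trans (trans (reflexive (≡.cong φ (point-wrap h h′ i j r i+j≡k+r)))
                     (trans (lin (+∈ (+∈ h∈ h′∈) ka∈) r<k)
                            (∙-congʳ (trans (add (+∈ h∈ h′∈) ka∈) (∙-cong (add h∈ h′∈) top)))))
              -- Multiples of φ(a) with variable coefficients are atoms for the solver, so i + j = k
              -- + r has to enter as an equation between them.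
              (trans (SM.combine
                        (trans (sym (×ℕ-homo-+ (φ a) k r)) (trans (reflexive (≡.cong (_×ℕ φ a) (≡.sym i+j≡k+r))) (×ℕ-homo-+ (φ a) i j)))
                        (SM.solve 6 (λ h h′ x y w z →
                             (((h SM.:+ h′) SM.:+ w) SM.:+ z) SM.:+ (x SM.:+ y)
                          ⊜ᴹ ((h SM.:+ x) SM.:+ (h′ SM.:+ y)) SM.:+ (w SM.:+ z))
                          refl (φ h) (φ h′) (i ×ℕ φ a) (j ×ℕ φ a) (k ×ℕ φ a) (r ×ℕ φ a)))
                     (sym (∙-cong (lin h∈ i<k) (lin h′∈ j<k))))
        where open SM using () renaming (_⊜_ to _⊜ᴹ_)

  -- Relations between four elements, and the induction step along the chain of subgroups.

  record Quad : Set where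
    constructor ⟨_,_∣_,_⟩
    field p q r s : A

  -- The remaining inequalities q ≠ r and q ≠ s follow from p ≠ s and p ≠ r by cancelling in p + q =
  -- r + s.
  record Proper (Q : Quad) : Set where
    open Quad Q
    field
      balanced : p + q ≡ r + s
      p≢q : p ≢ q
      r≢s : r ≢ s
      p≢r : p ≢ r
      p≢s : p ≢ s

  module _ (M : AbelianGroup 0ℓ 0ℓ) (φ : A → AbelianGroup.Carrier M) where
    open AbelianGroup M

    -- The additive extension of φ to integer vectors sends e_p + e_q - e_r - e_s to zero.
    Kills : Quad → Set
    Kills ⟨ p , q ∣ r , s ⟩ = φ p ∙ φ q ≈ φ r ∙ φ s

  -- Additivity is stated for every target group, because the group finally used is the quotient by
  -- the span of all relations, which is known only once the chain is complete.
  record Stage : Set₁ where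
    field
      D         : List A
      submonoid : Submonoid D
      quads     : List Quad
      size      : suc (length quads) ≡ length D
      proper    : ∀ {Q} → Q ∈ quads → Proper Q
      additive  : ∀ M φ → Pointed M φ →
                  (∀ {Q} → Q ∈ quads → Kills M φ Q) → AdditiveOn M φ D

  module Extend {D : List A} (S : Submonoid D) (a : A) {m : ℕ}
                (O : IsRelativeOrder D a (2 ℕ.+ m))
                (b : A) (b∈ : b ∈ D) (b≢0 : b ≢ 0#) (b≢ka : b ≢ (2 ℕ.+ m) * a) where
    open Submonoid S
    open IsRelativeOrder O
    private module E = Extension S a O

    a∉ : a ∉ D
    a∉ a∈ = minimal {1} (s≤s z≤n) (s≤s (s≤s z≤n)) (≡.subst (_∈ D) (≡.sym (identityʳ a)) a∈)

    side : A → Quad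
    side h = ⟨ h + a , 0# ∣ a , h ⟩

    -- Solved for its first entry, the relation gives level i + 2 of `h` from level i + 1 of h + b.
    -- Without the shift by `b` it would read (h + 2a) + h = (h + a) + (h + a) at i = 0, with a
    -- repeated entry.
    slope : A → ℕ → Quad
    slope h i = ⟨ h + ((2 ℕ.+ i) * a) , h + b ∣ (h + b) + (suc i * a) , h + a ⟩

    -- The side relation at h = 0 is void; its place in the grid is taken by the slope relation
    -- of level m + 2, which determines φ on the multiple of a that returns to D.
    quad : A × ℕ → Quad
    quad (h , zero)        = side h
    quad (h , suc zero)    with h Finₚ.≟ 0#
    ... | yes _ = slope 0# m
    ... | no  _ = side h
    quad (h , suc (suc i)) = slope h i

    side-proper : ∀ {h} → h ∈ D → h ≢ 0# → Proper (side h)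
    side-proper {h} h∈ h≢0 = record
      { balanced = SA.solve 2 (λ h a → (h :+ a) :+ :0 ⊜ a :+ h) ≡.refl h a
      ; p≢q = λ eq → a∉ (≡.subst (_∈ D) (≡.sym (SA.combine eq
                (SA.solve 2 (λ h a → a :+ :0 ⊜ (:- h) :+ (h :+ a)) ≡.refl h a))) (-∈ h∈))
      ; r≢s = λ { ≡.refl → a∉ h∈ }
      ; p≢r = λ eq → h≢0 (SA.combine eq (SA.solve 2 (λ h a → h :+ a ⊜ :0 :+ (h :+ a)) ≡.refl h a))
      ; p≢s = λ eq → a∉ (≡.subst (_∈ D) (≡.sym (SA.combine eq
                (SA.solve 2 (λ h a → a :+ h ⊜ :0 :+ (h :+ a)) ≡.refl h a))) 0∈) }

    -- A coincidence of entries would put a multiple of `a` of level 1, ..., k - 1 into `D`, with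
    -- two exceptions: r = s at i = 0 means b = 0, and p = q at i = m means b = k a. These are the
    -- two values that `b` has to avoid.
    slope-proper : ∀ h {i} → i ≤ m → b ≢ (2 ℕ.+ i) * a → Proper (slope h i)
    slope-proper h {i} i≤m b≢ = record
      { balanced = SA.solve 4 (λ h a b x → (h :+ (a :+ x)) :+ (h :+ b) ⊜ ((h :+ b) :+ x) :+ (h :+ a))
                     ≡.refl h a b (suc i * a)
      ; p≢q = λ eq → b≢ (≡.sym (∙-cancelˡ h _ _ eq))
      ; r≢s = λ eq → r≢s i i≤m (SA.combine eq
                (SA.solve 4 (λ h a b x → (b :+ x) :+ (h :+ a) ⊜ :0 :+ ((h :+ b) :+ (a :+ x))) ≡.refl h a b (i * a)))
      ; p≢r = λ eq → a∉ (≡.subst (_∈ D) (≡.sym (SA.combine eq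
                (SA.solve 4 (λ h a b x → a :+ ((h :+ b) :+ x) ⊜ b :+ (h :+ (a :+ x))) ≡.refl h a b (suc i * a)))) b∈)
      ; p≢s = λ eq → minimal {suc i} (s≤s z≤n) (s≤s (s≤s i≤m)) (≡.subst (_∈ D) (≡.sym (SA.combine eq
                (SA.solve 3 (λ h a x → x :+ (h :+ a) ⊜ :0 :+ (h :+ (a :+ x))) ≡.refl h a (suc i * a)))) 0∈) }
      where
      r≢s : ∀ i → i ≤ m → b + (i * a) ≢ 0#
      r≢s zero    _   eq = b≢0 (≡.trans (≡.sym (identityʳ b)) eq)
      r≢s (suc i) i<m eq = minimal {suc i} (s≤s z≤n) (s≤s (ℕₚ.m≤n⇒m≤1+n i<m))
        (≡.subst (_∈ D) (≡.sym (SA.combine eq (SA.solve 2 (λ b x → x :+ :0 ⊜ (:- b) :+ (b :+ x)) ≡.refl b (suc i * a))))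
          (-∈ b∈))

    quad-proper : ∀ {c} → c ∈ E.grid → Proper (quad c)
    quad-proper {h , j} c∈ with E.∈grid⁻ {h} {j} c∈
    quad-proper {h , zero} c∈        | h∈ , () , _
    quad-proper {h , suc zero} c∈    | h∈ , _ , _ with h Finₚ.≟ 0#
    ... | yes _  = slope-proper 0# ℕₚ.≤-refl b≢ka
    ... | no h≢0 = side-proper h∈ h≢0
    quad-proper {h , suc (suc i)} c∈ | h∈ , _ , j<k@(s≤s (s≤s i<m)) =
      slope-proper h (ℕₚ.<⇒≤ i<m) λ { ≡.refl → minimal (s≤s z≤n) j<k b∈ }

    module _ (M : AbelianGroup 0ℓ 0ℓ) (φ : A → AbelianGroup.Carrier M) where
      open AbelianGroup M using (_≈_; _∙_; ε; refl; trans; sym; reflexive; ∙-cong; ∙-congˡ; ∙-congʳ)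
        renaming (identityʳ to identityʳᴹ; identityˡ to identityˡᴹ)
      open IntegerMultiples M using (_×ℕ_)
      private module SM = AbelianGroupSolver M

      module _ (φ0 : φ 0# ≈ ε) (kill : ∀ {c} → c ∈ E.grid → Kills M φ (quad c)) where

        φ-side : ∀ {h} → h ∈ D → φ (h + a) ≈ φ h ∙ φ a
        -- Abstracting the killed relation together with the test makes its type reduce along the
        -- case split of `quad`.
        φ-side {h} h∈ with h Finₚ.≟ 0# | kill (E.∈grid⁺ {h} {1} h∈ (s≤s z≤n) (s≤s (s≤s z≤n)))
        ... | yes ≡.refl | _ = trans (reflexive (≡.cong φ (identityˡ a)))
                                 (trans (sym (identityˡᴹ _)) (∙-congʳ (sym φ0)))
        ... | no _ | eq = SM.combine (∙-cong eq (sym φ0))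
              (SM.solve 4 (λ x z a h → x SM.:+ ((a SM.:+ h) SM.:+ z) SM.⊜ (h SM.:+ a) SM.:+ ((x SM.:+ z) SM.:+ SM.:0))
                 refl (φ (h + a)) (φ 0#) (φ a) (φ h))

        φ-slope : ∀ {h} i → h ∈ D → Kills M φ (slope h i) →
                  φ ((h + b) + (suc i * a)) ≈ φ (h + b) ∙ suc i ×ℕ φ a →
                  φ (h + ((2 ℕ.+ i) * a)) ≈ φ h ∙ (2 ℕ.+ i) ×ℕ φ a
        φ-slope {h} i h∈ eq below = SM.combine (∙-cong eq (∙-cong below (φ-side h∈)))
          (SM.solve 7 (λ w hb x ha h a y →
               w SM.:+ ((x SM.:+ ha) SM.:+ ((hb SM.:+ y) SM.:+ (h SM.:+ a)))
            SM.⊜ (h SM.:+ (a SM.:+ y)) SM.:+ ((w SM.:+ hb) SM.:+ (x SM.:+ ha)))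
            refl (φ (h + ((2 ℕ.+ i) * a))) (φ (h + b)) (φ ((h + b) + (suc i * a))) (φ (h + a)) (φ h) (φ a) (suc i ×ℕ φ a))

        -- Induction on the level with `h` varying, since a slope relation passes to h + b while it
        -- descends by one level.
        φ-point : ∀ {h} j → h ∈ D → j < 2 ℕ.+ m → φ (E.point (h , j)) ≈ φ h ∙ j ×ℕ φ a
        φ-point {h} zero          h∈ _ = trans (reflexive (≡.cong φ (identityʳ h))) (sym (identityʳᴹ _))
        φ-point {h} (suc zero)    h∈ _ = trans (reflexive (≡.cong (λ x → φ (h + x)) (identityʳ a)))
                                           (trans (φ-side h∈) (∙-congˡ (sym (identityʳᴹ _))))
        φ-point {h} (suc (suc i)) h∈ j<k = φ-slope i h∈
          (kill (E.∈grid⁺ {h} {suc (suc i)} h∈ (s≤s z≤n) j<k)) (φ-point (suc i) (+∈ h∈ b∈) (ℕₚ.<-trans (ℕₚ.n<1+n _) j<k))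

        -- The relation stored in cell (0, 1) is the slope relation of level k at h = 0; level k - 1
        -- is already known from `φ-point`.
        φ-top : φ ((2 ℕ.+ m) * a) ≈ (2 ℕ.+ m) ×ℕ φ a
        φ-top with 0# Finₚ.≟ 0# | kill (E.∈grid⁺ {0#} {1} 0∈ (s≤s z≤n) (s≤s (s≤s z≤n)))
        ... | no 0≢0 | _  = contradiction ≡.refl 0≢0
        ... | yes _  | eq = trans (reflexive (≡.cong φ (≡.sym (identityˡ _))))
              (trans (φ-slope m 0∈ eq (φ-point (suc m) (+∈ 0∈ b∈) ℕₚ.≤-refl)) (trans (∙-congʳ φ0) (identityˡᴹ _)))

        additive⁺ : AdditiveOn M φ D → AdditiveOn M φ E.D⁺
        additive⁺ add = E.glue M φ add (λ {h} {j} → φ-point {h} j) φ-top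

    -- The extra relations need to give additivity on `D` only with the help of the side relations
    -- of the new coset. A full stage on `D` is one instance; subgroups of order 2 and 3, which
    -- carry no stage, are the other.
    extend : (extra : List Quad) → suc (length extra) ≡ length D →
             (∀ {Q} → Q ∈ extra → Proper Q) →
             (∀ M φ → Pointed M φ → (∀ {Q} → Q ∈ extra → Kills M φ Q) →
                TranslatesBy M φ a D → AdditiveOn M φ D) → Stage
    extend extra size extra-proper extra-additive = record
      { D         = E.D⁺
      ; submonoid = E.submonoid
      ; quads     = extra ++ map quad E.grid
      ; size      = begin
          suc (length (extra ++ map quad E.grid))            ≡⟨ ≡.cong suc (Listₚ.length-++ extra) ⟩
          suc (length extra) ℕ.+ length (map quad E.grid)    ≡⟨ ≡.cong₂ ℕ._+_ size (Listₚ.length-map quad E.grid) ⟩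
          length D ℕ.+ length E.grid                         ≡⟨ ≡.cong (length D ℕ.+_) (Listₚ.length-map E.point E.grid) ⟨
          length D ℕ.+ length (map E.point E.grid)           ≡⟨ Listₚ.length-++ D ⟨
          length E.D⁺                                        ∎
      ; proper    = λ Q∈ → proper⁺ (∈-++⁻ extra Q∈)
      ; additive  = λ M φ φ0 kill →
          let kill-grid = λ {c} (c∈ : c ∈ E.grid) → kill (∈-++⁺ʳ extra (∈-map⁺ quad c∈)) in
          additive⁺ M φ φ0 kill-grid
            (extra-additive M φ φ0 (λ Q∈ → kill (∈-++⁺ˡ Q∈)) (φ-side M φ φ0 kill-grid)) }
      where
      open ≡.≡-Reasoning
      proper⁺ : ∀ {Q} → Q ∈ extra ⊎ Q ∈ map quad E.grid → Proper Q
      proper⁺ (inj₁ Q∈) = extra-proper Q∈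
      proper⁺ (inj₂ Q∈) with ∈-map⁻ quad Q∈
      ... | c , c∈ , ≡.refl = quad-proper c∈

  1<relativeOrder : ∀ {D a k} → a ∉ D → IsRelativeOrder D a k → 1 < k
  1<relativeOrder {k = zero}        a∉ O = contradiction (IsRelativeOrder.positive O) λ ()
  1<relativeOrder {k = suc zero}    a∉ O = contradiction (≡.subst (_∈ _) (identityʳ _) (IsRelativeOrder.ka∈ O)) a∉
  1<relativeOrder {k = suc (suc k)} a∉ O = s≤s (s≤s z≤n)

  unique-length≤ : ∀ {xs : List A} → Unique xs → length xs ≤ N
  unique-length≤ {xs} uxs = ≡.subst (length xs ≤_) (Listₚ.length-tabulate (λ i → i))
    (unique-⊆⇒length-≤ uxs λ {x} _ → ∈-allFin x)

  point∈D⁺ : ∀ {D} (S : Submonoid D) {a k} (O : IsRelativeOrder D a k) → a ∉ D → a ∈ Extension.D⁺ S a O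
  point∈D⁺ S {a} {k} O a∉ = ≡.subst (_∈ Extension.D⁺ S a O) (≡.trans (identityˡ _) (identityʳ a))
    (Extension.point∈ S a O (Submonoid.0∈ S) (1<relativeOrder a∉ O))

  -- A missing element could be prepended, giving N + 1 distinct elements.
  unique-full : ∀ {xs : List A} → Unique xs → length xs ≡ N → ∀ x → x ∈ xs
  unique-full {xs} uxs len x = decidable-stable (x ∈A? xs) λ x∉ →
    ℕₚ.<⇒≢ (unique-length≤ {xs = x ∷ xs} (All.tabulate (λ { y∈ ≡.refl → x∉ y∈ }) ∷ uxs)) len

  length<D⁺ : ∀ {D} (S : Submonoid D) {a k} (O : IsRelativeOrder D a k) → a ∉ D →
              length D < length (Extension.D⁺ S a O)
  length<D⁺ {D} S {a} O a∉ = unique-⊆⇒length-≤ {xs = a ∷ D}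
    (All.tabulate (λ { x∈ ≡.refl → a∉ x∈ }) ∷ Submonoid.unique S)
    λ { (here ≡.refl) → point∈D⁺ S O a∉ ; (there x∈) → ∈-++⁺ˡ x∈ }

  -- More than two elements in `D` leave a choice of `b` different from 0 and k a.
  extendStage : (T : Stage) → 2 < length (Stage.D T) → ∀ {a} → a ∉ Stage.D T →
                Σ Stage λ T′ → length (Stage.D T) < length (Stage.D T′)
  extendStage T big {a} a∉ with relativeOrder (Stage.submonoid T) a
  ... | k , O with k | 1<relativeOrder a∉ O | O
  ... | suc zero    | s≤s () | _
  ... | suc (suc m) | _      | O with ∃-outside {ys = 0# ∷ ((2 ℕ.+ m) * a) ∷ []} (Submonoid.unique (Stage.submonoid T)) big
  ...   | b , b∈ , b∉ =
    Extend.extend S a O b b∈ (λ { ≡.refl → b∉ (here ≡.refl) }) (λ eq → b∉ (there (here eq)))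
      quads size proper (λ M φ φ0 kill _ → additive M φ φ0 kill)
    , length<D⁺ S O a∉
    where open Stage T renaming (submonoid to S)

  -- Each extension enlarges `D`, which has at most N elements, so N units of fuel suffice: once the
  -- fuel is spent `D` already has N elements and nothing lies outside it.
  fullStage : (T : Stage) → 2 < length (Stage.D T) → Σ Stage λ T′ → ∀ x → x ∈ Stage.D T′
  fullStage T big = go N T big (ℕₚ.m≤m+n N _)
    where
    go : ∀ fuel (T : Stage) → 2 < length (Stage.D T) → N ≤ fuel ℕ.+ length (Stage.D T) →
         Σ Stage λ T′ → ∀ x → x ∈ Stage.D T′
    go fuel T big enough with Finₚ.any? (λ x → ¬? (x ∈A? Stage.D T))
    ... | no all = T , λ x → decidable-stable (x ∈A? Stage.D T) λ x∉ → all (x , x∉)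
    go fuel T big enough | yes (a , a∉) with extendStage T big a∉
    go zero T big enough | yes (a , a∉) | T′ , bigger =
      contradiction (ℕₚ.≤-trans bigger (unique-length≤ (Submonoid.unique (Stage.submonoid T′)))) (ℕₚ.≤⇒≯ enough)
    go (suc fuel) T big enough | yes (a , a∉) | T′ , bigger =
      go fuel T′ (ℕₚ.<-trans big bigger)
        (ℕₚ.≤-trans enough (ℕₚ.≤-trans (ℕₚ.≤-reflexive (≡.sym (ℕₚ.+-suc fuel _))) (ℕₚ.+-monoʳ-≤ fuel bigger)))

  trivial-additive : ∀ M φ → Pointed M φ → AdditiveOn M φ (0# ∷ [])
  trivial-additive M φ φ0 (here ≡.refl) (here ≡.refl) =
    trans (reflexive (≡.cong φ (identityˡ 0#))) (trans (sym (identityˡᴹ _)) (∙-congʳ (sym φ0)))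
    where open AbelianGroup M using (trans; sym; reflexive; ∙-congʳ) renaming (identityˡ to identityˡᴹ)

  -- Starting stages: long cyclic groups, ℤ₂ × ℤ₂ and ℤ₃ × ℤ₃.

  module Cyclic (a : A) {k : ℕ} (O : IsRelativeOrder (0# ∷ []) a k) where
    open IsRelativeOrder O
    module E = Extension trivial a O

    k*a≡0 : k * a ≡ 0#
    k*a≡0 with ka∈
    ... | here eq = eq

    multiple∈ : ∀ {j} → j < k → j * a ∈ E.D⁺
    multiple∈ {j} j<k = ≡.subst (_∈ E.D⁺) (identityˡ _) (E.point∈ (here ≡.refl) j<k)

    *-≢0 : ∀ {j} → 0 < j → j < k → j * a ≢ 0#
    *-≢0 0<j j<k eq = minimal 0<j j<k (here eq)

    *-≢ : ∀ i d → 0 < d → d < k → (i ℕ.+ d) * a ≢ i * a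
    *-≢ i d 0<d d<k eq = *-≢0 0<d d<k (∙-cancelˡ (i * a) _ _
      (≡.trans (≡.sym (*-homo-+ a i d)) (≡.trans eq (≡.sym (identityʳ _)))))

    length-D⁺ : length E.D⁺ ≡ k
    length-D⁺ = ≡.trans (≡.cong suc (≡.trans (Listₚ.length-map E.point E.grid) (length-grid _))) E.k≡
      where
      length-grid : ∀ n → length (cartesianProduct (0# ∷ []) (applyUpTo ℕ.suc n)) ≡ n
      length-grid n = ≡.trans (≡.cong length (Listₚ.++-identityʳ (map (0# ,_) (applyUpTo ℕ.suc n))))
        (≡.trans (Listₚ.length-map (0# ,_) (applyUpTo ℕ.suc n)) (Listₚ.length-applyUpTo ℕ.suc n))

    -- This is `glue` over the trivial subgroup, where k a = 0 turns the condition at the top into k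
    -- φ(a) = 0.
    cyclic-additive : ∀ M φ → Pointed M φ →
                      MultiplicativeBelow M φ k a → Annihilates M φ k a → AdditiveOn M φ E.D⁺
    cyclic-additive M φ φ0 lin top = E.glue M φ (trivial-additive M φ φ0)
      (λ { (here ≡.refl) j<k → trans (reflexive (≡.cong φ (identityˡ _)))
                                 (trans (lin j<k) (trans (sym (identityˡᴹ _)) (∙-congʳ (sym φ0)))) })
      (trans (reflexive (≡.cong φ k*a≡0)) (trans φ0 (sym top)))
      where open AbelianGroup M using (trans; sym; reflexive; ∙-congʳ) renaming (identityˡ to identityˡᴹ)

  module LongCyclic (a : A) {m : ℕ} (O : IsRelativeOrder (0# ∷ []) a (5 ℕ.+ m)) where
    open Cyclic a O

    -- Relations 0 and 2 together give φ(2a) = 2 φ(a), since φ(3a) and φ(4a) cancel; relation 1 then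
    -- gives φ(3a) = 3 φ(a), and each relation from number 2 on gives the next multiple. Relation 0
    -- needs 0, a, 3a and 4a distinct, which requires order at least 5.
    quad : ℕ → Quad
    quad 0 = ⟨ 0# , 4 * a ∣ 1 * a , 3 * a ⟩
    quad 1 = ⟨ 3 * a , 0# ∣ 2 * a , 1 * a ⟩
    -- At the last index, i = m + 1, the first entry is k a = 0, which closes the cycle and yields k
    -- φ(a) = 0.
    quad (suc (suc i)) = ⟨ (4 ℕ.+ i) * a , 1 * a ∣ (3 ℕ.+ i) * a , 2 * a ⟩

    <k : ∀ {j} → j ≤ 4 → j < 5 ℕ.+ m
    <k j≤4 = s≤s (ℕₚ.≤-trans j≤4 (ℕₚ.m≤m+n 4 m))

    quad-proper : ∀ {i} → i < 4 ℕ.+ m → Proper (quad i)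
    quad-proper {0} _ = record
      { balanced = SA.solve 1 (λ a → :0 :+ (a :+ (a :+ (a :+ (a :+ :0)))) ⊜ (a :+ :0) :+ (a :+ (a :+ (a :+ :0)))) ≡.refl a
      ; p≢q = λ eq → *-≢0 {4} (s≤s z≤n) (<k (ℕₚ.m≤m+n 4 0)) (≡.sym eq)
      ; r≢s = λ eq → *-≢ 1 2 (s≤s z≤n) (<k (ℕₚ.m≤m+n 2 2)) (≡.sym eq)
      ; p≢r = λ eq → *-≢0 {1} (s≤s z≤n) (<k (ℕₚ.m≤m+n 1 3)) (≡.sym eq)
      ; p≢s = λ eq → *-≢0 {3} (s≤s z≤n) (<k (ℕₚ.m≤m+n 3 1)) (≡.sym eq) }
    quad-proper {1} _ = record
      { balanced = SA.solve 1 (λ a → (a :+ (a :+ (a :+ :0))) :+ :0 ⊜ (a :+ (a :+ :0)) :+ (a :+ :0)) ≡.refl a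
      ; p≢q = *-≢0 {3} (s≤s z≤n) (<k (ℕₚ.m≤m+n 3 1))
      ; r≢s = *-≢ 1 1 (s≤s z≤n) (<k (ℕₚ.m≤m+n 1 3))
      ; p≢r = *-≢ 2 1 (s≤s z≤n) (<k (ℕₚ.m≤m+n 1 3))
      ; p≢s = *-≢ 1 2 (s≤s z≤n) (<k (ℕₚ.m≤m+n 2 2)) }
    quad-proper {suc (suc i)} (s≤s (s≤s (s≤s i≤m+1))) = record
      { balanced = SA.solve 2 (λ a x → (a :+ x) :+ (a :+ :0) ⊜ x :+ (a :+ (a :+ :0))) ≡.refl a ((3 ℕ.+ i) * a)
      ; p≢q = *-≢ 1 (3 ℕ.+ i) (s≤s z≤n) (s≤s (s≤s (s≤s (s≤s i≤m+1))))
      ; r≢s = *-≢ 2 (1 ℕ.+ i) (s≤s z≤n) (s≤s (s≤s (ℕₚ.m≤n⇒m≤1+n (ℕₚ.m≤n⇒m≤1+n i≤m+1))))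
      ; p≢r = λ eq → *-≢ (3 ℕ.+ i) 1 (s≤s z≤n) (<k (ℕₚ.m≤m+n 1 3)) (≡.trans (≡.cong (_* a) (ℕₚ.+-comm (3 ℕ.+ i) 1)) eq)
      ; p≢s = *-≢ 2 (2 ℕ.+ i) (s≤s z≤n) (s≤s (s≤s (s≤s (ℕₚ.m≤n⇒m≤1+n i≤m+1)))) }

    module _ (M : AbelianGroup 0ℓ 0ℓ) (φ : A → AbelianGroup.Carrier M) where
      open AbelianGroup M using (_≈_; _∙_; ε; refl; trans; sym; reflexive; ∙-cong; ∙-congˡ; ∙-congʳ)
        renaming (identityʳ to identityʳᴹ; identityˡ to identityˡᴹ)
      open IntegerMultiples M using (_×ℕ_)
      private module SM = AbelianGroupSolver M

      module _ (φ0 : φ 0# ≈ ε) (kill : ∀ {i} → i < 4 ℕ.+ m → Kills M φ (quad i)) where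

        φ1 : φ (1 * a) ≈ φ a
        φ1 = reflexive (≡.cong φ (identityʳ a))

        φ2 : φ (2 * a) ≈ 2 ×ℕ φ a
        φ2 = SM.combine (∙-cong (kill {0} (s≤s z≤n)) (∙-cong (sym (kill {2} (s≤s (s≤s (s≤s z≤n))))) (∙-cong (∙-cong φ1 φ1) (sym φ0))))
          (SM.solve 6 (λ x0 x1 x2 x3 x4 a →
               x2 SM.:+ ((x1 SM.:+ x3) SM.:+ ((x4 SM.:+ x1) SM.:+ ((a SM.:+ a) SM.:+ x0)))
            SM.⊜ (a SM.:+ (a SM.:+ SM.:0)) SM.:+ ((x0 SM.:+ x4) SM.:+ ((x3 SM.:+ x2) SM.:+ ((x1 SM.:+ x1) SM.:+ SM.:0))))
            refl (φ 0#) (φ (1 * a)) (φ (2 * a)) (φ (3 * a)) (φ (4 * a)) (φ a))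

        φ* : ∀ j → j ≤ 5 ℕ.+ m → φ (j * a) ≈ j ×ℕ φ a
        φ* zero                      _ = φ0
        φ* (suc zero)                _ = trans φ1 (sym (identityʳᴹ _))
        φ* (suc (suc zero))          _ = φ2
        φ* (suc (suc (suc zero)))    _ = SM.combine
          (∙-cong (kill {1} (s≤s (s≤s z≤n))) (∙-cong φ1 (∙-cong φ2 (sym φ0))))
          (SM.solve 5 (λ x0 x1 x2 x3 a →
               x3 SM.:+ ((x2 SM.:+ x1) SM.:+ (a SM.:+ ((a SM.:+ (a SM.:+ SM.:0)) SM.:+ x0)))
            SM.⊜ (a SM.:+ (a SM.:+ (a SM.:+ SM.:0))) SM.:+ ((x3 SM.:+ x0) SM.:+ (x1 SM.:+ (x2 SM.:+ SM.:0))))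
            refl (φ 0#) (φ (1 * a)) (φ (2 * a)) (φ (3 * a)) (φ a))
        φ* (suc j@(suc (suc (suc i)))) (s≤s (s≤s (s≤s j≤))) = SM.combine
          (∙-cong (kill {2 ℕ.+ i} (s≤s (s≤s j≤))) (∙-cong (sym φ1) (∙-cong φ2 (φ* j (s≤s (s≤s (s≤s (ℕₚ.<⇒≤ j≤))))))))
          (SM.solve 6 (λ x1 x2 y z w a →
               z SM.:+ ((y SM.:+ x2) SM.:+ (x1 SM.:+ ((a SM.:+ (a SM.:+ SM.:0)) SM.:+ w)))
            SM.⊜ (a SM.:+ w) SM.:+ ((z SM.:+ x1) SM.:+ (a SM.:+ (x2 SM.:+ y))))
            refl (φ (1 * a)) (φ (2 * a)) (φ ((3 ℕ.+ i) * a)) (φ ((4 ℕ.+ i) * a)) ((3 ℕ.+ i) ×ℕ φ a) (φ a))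

    stage : Stage
    stage = record
      { D         = E.D⁺
      ; submonoid = E.submonoid
      ; quads     = applyUpTo quad (4 ℕ.+ m)
      ; size      = ≡.trans (≡.cong suc (Listₚ.length-applyUpTo quad (4 ℕ.+ m))) (≡.sym length-D⁺)
      ; proper    = λ Q∈ → proper (∈-applyUpTo⁻ quad Q∈)
      ; additive  = additive }
      where
      proper : ∀ {Q} → ∃[ i ] i < 4 ℕ.+ m × Q ≡ quad i → Proper Q
      proper (i , i< , ≡.refl) = quad-proper i<

      additive : ∀ M φ → Pointed M φ →
                 (∀ {Q} → Q ∈ applyUpTo quad (4 ℕ.+ m) → Kills M φ Q) → AdditiveOn M φ E.D⁺
      additive M φ φ0 kill = cyclic-additive M φ φ0 (λ {j} j<k → multiples j (ℕₚ.<⇒≤ j<k))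
        (trans (sym (multiples (5 ℕ.+ m) ℕₚ.≤-refl)) (trans (reflexive (≡.cong φ k*a≡0)) φ0))
        where
        open AbelianGroup M using (trans; sym; reflexive)
        multiples = φ* M φ φ0 λ i< → kill (∈-applyUpTo⁺ quad i<)

    length-stage : 2 < length E.D⁺
    length-stage = ≡.subst (2 <_) (≡.sym length-D⁺) (<k (ℕₚ.m≤m+n 2 2))

  infixr 8 _⊛_
  -- Unfolds with a final zero exactly as `k * x` does, so that solver expressions match concrete
  -- multiples definitionally.
  _⊛_ : ∀ {n} → ℕ → SA.Expr n → SA.Expr n
  zero  ⊛ e = :0
  suc k ⊛ e = e :+ (k ⊛ e)

  infixr 5 _⊞_
  _⊞_ : ∀ {x y u v : A} → x ≡ y → u ≡ v → x + u ≡ y + v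
  _⊞_ = ≡.cong₂ _+_

  relativeOrder-2 : ∀ {D a} → a ∉ D → 2 * a ∈ D → IsRelativeOrder D a 2
  relativeOrder-2 {D} {a} a∉ 2a∈ = record
    { positive = s≤s z≤n
    ; ka∈      = 2a∈
    ; minimal  = λ { {1} _ _ 1a∈ → a∉ (≡.subst (_∈ D) (identityʳ a) 1a∈)
                   ; {suc (suc j)} _ (s≤s (s≤s ())) } }

  relativeOrder-3 : ∀ {D a} → a ∉ D → 2 * a ∉ D → 3 * a ∈ D → IsRelativeOrder D a 3
  relativeOrder-3 {D} {a} a∉ 2a∉ 3a∈ = record
    { positive = s≤s z≤n
    ; ka∈      = 3a∈
    ; minimal  = λ { {1} _ _ 1a∈ → a∉ (≡.subst (_∈ D) (identityʳ a) 1a∈)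
                   ; {2} _ _ → 2a∉
                   ; {suc (suc (suc j))} _ (s≤s (s≤s (s≤s ()))) } }

  module Klein {a b : A} (a≢0 : a ≢ 0#) (b≢0 : b ≢ 0#) (a≢b : a ≢ b)
               (2a≡0 : 2 * a ≡ 0#) (2b≡0 : 2 * b ≡ 0#) where

    Ob : IsRelativeOrder (0# ∷ []) b 2
    Ob = relativeOrder-2 (λ { (here eq) → b≢0 eq }) (here 2b≡0)

    open Cyclic b Ob
    open Submonoid E.submonoid

    b∈ : b ∈ E.D⁺
    b∈ = ≡.subst (_∈ E.D⁺) (identityʳ b) (multiple∈ {1} (s≤s (s≤s z≤n)))

    a∉ : a ∉ E.D⁺
    a∉ (here eq)         = a≢0 eq
    a∉ (there (here eq)) = a≢b (≡.trans eq (≡.trans (identityˡ _) (identityʳ b)))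

    Oa : IsRelativeOrder E.D⁺ a 2
    Oa = relativeOrder-2 a∉ (≡.subst (_∈ E.D⁺) (≡.sym 2a≡0) 0∈)

    -- With the side relation at `b` it reads φ(a) = 2 φ(b) + φ(a), so 2 φ(b) = 0. The three
    -- relations of the resulting stage are the three splittings of the four elements into two
    -- pairs.
    extra : Quad
    extra = ⟨ 0# , a ∣ b , b + a ⟩

    extra-proper : Proper extra
    extra-proper = record
      { balanced = SA.combine (≡.sym 2b≡0)
          (SA.solve 2 (λ a b → (:0 :+ a) :+ (2 ⊛ b) ⊜ (b :+ (b :+ a)) :+ :0) ≡.refl a b)
      ; p≢q = λ eq → a≢0 (≡.sym eq)
      ; r≢s = λ eq → a≢0 (SA.combine (≡.sym eq) (SA.solve 2 (λ a b → a :+ b ⊜ :0 :+ (b :+ a)) ≡.refl a b))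
      ; p≢r = λ eq → b≢0 (≡.sym eq)
      ; p≢s = λ eq → a≢b (SA.combine (≡.sym eq ⊞ ≡.sym 2b≡0)
          (SA.solve 2 (λ a b → a :+ (:0 :+ (2 ⊛ b)) ⊜ b :+ ((b :+ a) :+ :0)) ≡.refl a b)) }

    stage : Stage
    stage = Extend.extend E.submonoid a Oa b b∈ b≢0 (λ eq → b≢0 (≡.trans eq 2a≡0))
      (extra ∷ []) ≡.refl (λ { (here ≡.refl) → extra-proper }) additive
      where
      additive : ∀ M φ → Pointed M φ →
                 (∀ {Q} → Q ∈ extra ∷ [] → Kills M φ Q) →
                 TranslatesBy M φ a E.D⁺ → AdditiveOn M φ E.D⁺
      additive M φ φ0 kill side = cyclic-additive M φ φ0
        (λ { {0} _ → φ0
           ; {1} _ → trans (reflexive (≡.cong φ (identityʳ b))) (sym (identityʳᴹ _))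
           ; {suc (suc j)} (s≤s (s≤s ())) })
        (SM.combine (∙-cong (sym (kill (here ≡.refl))) (∙-cong (sym (side b∈)) φ0))
          (SM.solve 4 (λ z a b c →
               (b SM.:+ (b SM.:+ SM.:0)) SM.:+ ((z SM.:+ a) SM.:+ (c SM.:+ SM.:0))
            SM.⊜ SM.:0 SM.:+ ((b SM.:+ c) SM.:+ ((b SM.:+ a) SM.:+ z)))
            refl (φ 0#) (φ a) (φ b) (φ (b + a))))
        where
        open AbelianGroup M using (refl; trans; sym; reflexive; ∙-cong) renaming (identityʳ to identityʳᴹ)
        module SM = AbelianGroupSolver M

    length-stage : 2 < length (Stage.D stage)
    length-stage = length<D⁺ E.submonoid Oa a∉

  module ThreeThree {a b : A} (b≢0 : b ≢ 0#) (a∉′ : a ∉ 0# ∷ b ∷ 2 * b ∷ [])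
                    (3a≡0 : 3 * a ≡ 0#) (3b≡0 : 3 * b ≡ 0#) where

    Ob : IsRelativeOrder (0# ∷ []) b 3
    Ob = relativeOrder-3 (λ { (here eq) → b≢0 eq })
      (λ { (here eq) → b≢0 (SA.combine (3b≡0 ⊞ ≡.sym eq)
             (SA.solve 1 (λ b → b :+ (:0 :+ (2 ⊛ b)) ⊜ :0 :+ ((3 ⊛ b) :+ :0)) ≡.refl b)) })
      (here 3b≡0)

    open Cyclic b Ob
    open Submonoid E.submonoid

    b∈ : b ∈ E.D⁺
    b∈ = ≡.subst (_∈ E.D⁺) (identityʳ b) (multiple∈ {1} (s≤s (s≤s z≤n)))

    a∉ : a ∉ E.D⁺
    a∉ (here eq)                 = a∉′ (here eq)
    a∉ (there (here eq))         = a∉′ (there (here (≡.trans eq (≡.trans (identityˡ _) (identityʳ b)))))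
    a∉ (there (there (here eq))) = a∉′ (there (there (here (≡.trans eq (identityˡ _)))))

    a≢0 : a ≢ 0#
    a≢0 eq = a∉′ (here eq)

    Oa : IsRelativeOrder E.D⁺ a 3
    Oa = relativeOrder-3 a∉
      -- If 2a belonged to the subgroup, so would 2a + 2a = a.
      (λ 2a∈ → a∉ (≡.subst (_∈ E.D⁺) (SA.combine 3a≡0
         (SA.solve 1 (λ a → ((2 ⊛ a) :+ (2 ⊛ a)) :+ :0 ⊜ a :+ (3 ⊛ a)) ≡.refl a)) (+∈ 2a∈ 2a∈)))
      (≡.subst (_∈ E.D⁺) (≡.sym 3a≡0) 0∈)

    -- After φ(a) is cancelled by means of the side relations, these say φ(b) = 2 φ(2b) and φ(2b) =
    -- 2 φ(b). Hence φ(b) = 4 φ(b), that is 3 φ(b) = 0.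
    extra₁ extra₂ : Quad
    extra₁ = ⟨ b , a ∣ b + b , (b + b) + a ⟩
    extra₂ = ⟨ 0# , (b + b) + a ∣ b , b + a ⟩

    extra₁-proper : Proper extra₁
    extra₁-proper = record
      { balanced = SA.combine (≡.sym 3b≡0)
          (SA.solve 2 (λ a b → (b :+ a) :+ (3 ⊛ b) ⊜ ((b :+ b) :+ ((b :+ b) :+ a)) :+ :0) ≡.refl a b)
      ; p≢q = λ { ≡.refl → a∉ b∈ }
      ; r≢s = λ eq → a≢0 (SA.combine (≡.sym eq)
          (SA.solve 2 (λ a b → a :+ (b :+ b) ⊜ :0 :+ ((b :+ b) :+ a)) ≡.refl a b))
      ; p≢r = λ eq → b≢0 (SA.combine (≡.sym eq) (SA.solve 1 (λ b → b :+ b ⊜ :0 :+ (b :+ b)) ≡.refl b))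
      ; p≢s = λ eq → a∉ (≡.subst (_∈ E.D⁺) (SA.combine eq
          (SA.solve 2 (λ a b → (:- b) :+ ((b :+ b) :+ a) ⊜ a :+ b) ≡.refl a b)) (-∈ b∈)) }

    extra₂-proper : Proper extra₂
    extra₂-proper = record
      { balanced = SA.solve 2 (λ a b → :0 :+ ((b :+ b) :+ a) ⊜ b :+ (b :+ a)) ≡.refl a b
      ; p≢q = λ eq → a∉ (≡.subst (_∈ E.D⁺) (SA.combine eq
          (SA.solve 2 (λ a b → (:- (b :+ b)) :+ ((b :+ b) :+ a) ⊜ a :+ :0) ≡.refl a b)) (-∈ (+∈ b∈ b∈)))
      ; r≢s = λ eq → a≢0 (SA.combine (≡.sym eq) (SA.solve 2 (λ a b → a :+ b ⊜ :0 :+ (b :+ a)) ≡.refl a b))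
      ; p≢r = λ eq → b≢0 (≡.sym eq)
      ; p≢s = λ eq → a∉ (≡.subst (_∈ E.D⁺) (SA.combine eq
          (SA.solve 2 (λ a b → (:- b) :+ (b :+ a) ⊜ a :+ :0) ≡.refl a b)) (-∈ b∈)) }

    stage : Stage
    stage = Extend.extend E.submonoid a Oa b b∈ b≢0 (λ eq → b≢0 (≡.trans eq 3a≡0))
      (extra₁ ∷ extra₂ ∷ []) ≡.refl
      (λ { (here ≡.refl) → extra₁-proper ; (there (here ≡.refl)) → extra₂-proper }) additive
      where
      additive : ∀ M φ → Pointed M φ →
                 (∀ {Q} → Q ∈ extra₁ ∷ extra₂ ∷ [] → Kills M φ Q) →
                 TranslatesBy M φ a E.D⁺ → AdditiveOn M φ E.D⁺
      additive M φ φ0 kill side = cyclic-additive M φ φ0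
        (λ { {0} _ → φ0
           ; {1} _ → trans (reflexive (≡.cong φ (identityʳ b))) (sym (identityʳᴹ _))
           ; {2} _ → trans (reflexive (≡.cong (λ x → φ (b + x)) (identityʳ b))) y₂≈2y₁
           ; {suc (suc (suc j))} (s≤s (s≤s (s≤s ()))) })
        (SM.combine (∙-cong (sym y₁≈2y₂) (∙-cong (sym y₂≈2y₁) (sym y₂≈2y₁)))
          (SM.solve 2 (λ y₁ y₂ →
               (y₁ SM.:+ (y₁ SM.:+ (y₁ SM.:+ SM.:0))) SM.:+ (y₁ SM.:+ (y₂ SM.:+ y₂))
            SM.⊜ SM.:0 SM.:+ ((y₂ SM.:+ y₂) SM.:+ ((y₁ SM.:+ (y₁ SM.:+ SM.:0)) SM.:+ (y₁ SM.:+ (y₁ SM.:+ SM.:0)))))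
            refl (φ b) (φ (b + b))))
        where
        open AbelianGroup M using (_≈_; _∙_; refl; trans; sym; reflexive; ∙-cong) renaming (identityʳ to identityʳᴹ)
        open IntegerMultiples M using (_×ℕ_)
        module SM = AbelianGroupSolver M

        y₁≈2y₂ : φ b ≈ φ (b + b) ∙ φ (b + b)
        y₁≈2y₂ = SM.combine (∙-cong (kill (here ≡.refl)) (side (+∈ b∈ b∈)))
          (SM.solve 4 (λ y₁ y₂ x X₂ →
               y₁ SM.:+ ((y₂ SM.:+ X₂) SM.:+ (y₂ SM.:+ x))
            SM.⊜ (y₂ SM.:+ y₂) SM.:+ ((y₁ SM.:+ x) SM.:+ X₂))
            refl (φ b) (φ (b + b)) (φ a) (φ ((b + b) + a)))

        y₂≈2y₁ : φ (b + b) ≈ 2 ×ℕ φ b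
        y₂≈2y₁ = SM.combine (∙-cong (kill (there (here ≡.refl)))
                              (∙-cong (sym (side (+∈ b∈ b∈))) (∙-cong (side b∈) (sym φ0))))
          (SM.solve 6 (λ y₁ y₂ x X₁ X₂ z →
               y₂ SM.:+ ((y₁ SM.:+ X₁) SM.:+ (X₂ SM.:+ ((y₁ SM.:+ x) SM.:+ z)))
            SM.⊜ (y₁ SM.:+ (y₁ SM.:+ SM.:0)) SM.:+ ((z SM.:+ X₂) SM.:+ ((y₂ SM.:+ x) SM.:+ (X₁ SM.:+ SM.:0))))
            refl (φ b) (φ (b + b)) (φ a) (φ (b + a)) (φ ((b + b) + a)) (φ 0#))

    length-stage : 2 < length (Stage.D stage)
    length-stage = ℕₚ.<-trans (ℕₚ.n<1+n 2) (length<D⁺ E.submonoid Oa a∉)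

  -- Groups of order at least 4 that contain no starting stage.

  record CyclicFour : Set where
    field
      a    : A
      2a≢0 : 2 * a ≢ 0#
      4a≡0 : 4 * a ≡ 0#
      all  : ∀ x → x ∈ 0# ∷ a ∷ 2 * a ∷ 3 * a ∷ []

  -- When all three searches fail, every element is killed by 4 or by 3, the two kinds cannot mix,
  -- and 3-torsion alone would give at most three elements. What remains has exponent 4 and at most
  -- one element of order 2.
  stage-or-cyclicFour : 3 < N → (Σ Stage λ T → ∀ x → x ∈ Stage.D T) ⊎ CyclicFour
  stage-or-cyclicFour 3<N
    with Finₚ.any? (λ x → ¬? (1 * x Finₚ.≟ 0#) ×-dec ¬? (2 * x Finₚ.≟ 0#)
                          ×-dec ¬? (3 * x Finₚ.≟ 0#) ×-dec ¬? (4 * x Finₚ.≟ 0#))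
       | Finₚ.any? (λ x → Finₚ.any? (λ y → ¬? (x Finₚ.≟ 0#) ×-dec ¬? (y Finₚ.≟ 0#)
                          ×-dec ¬? (x Finₚ.≟ y) ×-dec (2 * x Finₚ.≟ 0#) ×-dec (2 * y Finₚ.≟ 0#)))
       | Finₚ.any? (λ x → Finₚ.any? (λ y → ¬? (y Finₚ.≟ 0#) ×-dec ¬? (x ∈A? (0# ∷ y ∷ 2 * y ∷ []))
                          ×-dec (3 * x Finₚ.≟ 0#) ×-dec (3 * y Finₚ.≟ 0#)))
  ... | yes (x , 1x≢0 , 2x≢0 , 3x≢0 , 4x≢0) | _ | _ = inj₁ (long (relativeOrder trivial x))
    where
    long : ∃[ k ] IsRelativeOrder (0# ∷ []) x k → Σ Stage λ T → ∀ y → y ∈ Stage.D T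
    long (0 , O) = contradiction (IsRelativeOrder.positive O) λ ()
    long (1 , O) = contradiction (IsRelativeOrder.ka∈ O) λ { (here eq) → 1x≢0 eq }
    long (2 , O) = contradiction (IsRelativeOrder.ka∈ O) λ { (here eq) → 2x≢0 eq }
    long (3 , O) = contradiction (IsRelativeOrder.ka∈ O) λ { (here eq) → 3x≢0 eq }
    long (4 , O) = contradiction (IsRelativeOrder.ka∈ O) λ { (here eq) → 4x≢0 eq }
    long (suc (suc (suc (suc (suc m)))) , O) = fullStage (LongCyclic.stage x O) (LongCyclic.length-stage x O)
  ... | no _ | yes (x , y , x≢0 , y≢0 , x≢y , 2x≡0 , 2y≡0) | _ =
    inj₁ (fullStage (Klein.stage x≢0 y≢0 x≢y 2x≡0 2y≡0) (Klein.length-stage x≢0 y≢0 x≢y 2x≡0 2y≡0))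
  ... | no _ | no _ | yes (x , y , y≢0 , x∉ , 3x≡0 , 3y≡0) =
    inj₁ (fullStage (ThreeThree.stage y≢0 x∉ 3x≡0 3y≡0) (ThreeThree.length-stage y≢0 x∉ 3x≡0 3y≡0))
  ... | no ¬long | no ¬klein | no ¬three = inj₂ cyclicFour
    where
    torsion : ∀ x → 4 * x ≡ 0# ⊎ 3 * x ≡ 0#
    torsion x with 1 * x Finₚ.≟ 0# | 2 * x Finₚ.≟ 0# | 3 * x Finₚ.≟ 0# | 4 * x Finₚ.≟ 0#
    ... | _ | _ | _ | yes eq = inj₁ eq
    ... | _ | _ | yes eq | _ = inj₂ eq
    ... | _ | yes eq | _ | _ = inj₁ (SA.combine (eq ⊞ eq)
            (SA.solve 1 (λ x → (4 ⊛ x) :+ (:0 :+ :0) ⊜ :0 :+ ((2 ⊛ x) :+ (2 ⊛ x))) ≡.refl x))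
    ... | yes eq | _ | _ | _ = inj₁ (SA.combine ((eq ⊞ eq) ⊞ (eq ⊞ eq))
            (SA.solve 1 (λ x → (4 ⊛ x) :+ ((:0 :+ :0) :+ (:0 :+ :0))
              ⊜ :0 :+ (((1 ⊛ x) :+ (1 ⊛ x)) :+ ((1 ⊛ x) :+ (1 ⊛ x)))) ≡.refl x))
    ... | no n₁ | no n₂ | no n₃ | no n₄ = contradiction (x , n₁ , n₂ , n₃ , n₄) ¬long

    -- The sum x + y is killed by 4 or by 3. In the first case 4x = 0, which together with 3x = 0
    -- contradicts x ≠ 0; in the second 3y = 0, which together with 4y = 0 gives y = 0.
    unmixed : ∀ {x y} → 3 * x ≡ 0# → x ≢ 0# → 4 * y ≡ 0# → y ≡ 0#
    unmixed {x} {y} 3x≡0 x≢0 4y≡0 with torsion (x + y)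
    ... | inj₁ eq = contradiction (SA.combine (eq ⊞ ≡.sym 3x≡0 ⊞ ≡.sym 4y≡0)
            (SA.solve 2 (λ x y → x :+ (:0 :+ ((3 ⊛ x) :+ (4 ⊛ y)))
              ⊜ :0 :+ ((4 ⊛ (x :+ y)) :+ (:0 :+ :0))) ≡.refl x y)) x≢0
    ... | inj₂ eq = SA.combine (4y≡0 ⊞ 3x≡0 ⊞ ≡.sym eq)
            (SA.solve 2 (λ x y → y :+ (:0 :+ (:0 :+ (3 ⊛ (x :+ y))))
              ⊜ :0 :+ ((4 ⊛ y) :+ ((3 ⊛ x) :+ :0))) ≡.refl x y)

    outside : ∀ ys → length ys ≤ 3 → ∃[ x ] x ∉ ys
    outside ys short with ∃-outside (Uniqueₚ.allFin⁺ N)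
      (ℕₚ.≤-<-trans short (≡.subst (3 <_) (≡.sym (Listₚ.length-tabulate (λ i → i))) 3<N))
    ... | x , _ , x∉ = x , x∉

    -- For x ≠ 0 there is room for some y outside 0, x, 2x. It is either killed by 4, hence zero by
    -- `unmixed`, or it completes a pair excluded by the third search.
    no-3-torsion : ∀ x → 3 * x ≡ 0# → x ≡ 0#
    no-3-torsion x 3x≡0 with x Finₚ.≟ 0#
    ... | yes x≡0 = x≡0
    ... | no x≢0 with outside (0# ∷ x ∷ 2 * x ∷ []) ℕₚ.≤-refl
    ...   | y , y∉ with torsion y
    ...     | inj₁ 4y≡0 = contradiction (here (unmixed 3x≡0 x≢0 4y≡0)) y∉
    ...     | inj₂ 3y≡0 = contradiction (y , x , x≢0 , y∉ , 3y≡0 , 3x≡0) ¬three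

    4-torsion : ∀ x → 4 * x ≡ 0#
    4-torsion x with torsion x
    ... | inj₁ eq = eq
    ... | inj₂ eq with no-3-torsion x eq
    ...   | ≡.refl = SA.solve 0 ((4 ⊛ :0) ⊜ :0) ≡.refl

    klein : ∀ {x y} → 2 * x ≡ 0# → x ≢ 0# → 2 * y ≡ 0# → y ≢ 0# → x ≡ y
    klein {x} {y} 2x≡0 x≢0 2y≡0 y≢0 = decidable-stable (x Finₚ.≟ y) λ x≢y →
      ¬klein (x , y , x≢0 , y≢0 , x≢y , 2x≡0 , 2y≡0)

    -- If a nonzero x has 2x = 0, any y other than 0 and x works, since only one element has order
    -- 2.
    element : ∃[ x ] 2 * x ≢ 0#
    element with outside (0# ∷ []) (s≤s z≤n)
    ... | x , x∉ with 2 * x Finₚ.≟ 0#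
    ...   | no 2x≢0 = x , 2x≢0
    ...   | yes 2x≡0 with outside (0# ∷ x ∷ []) (s≤s (s≤s z≤n))
    ...     | y , y∉ = y , λ 2y≡0 → y∉ (there (here (klein 2y≡0 (λ eq → y∉ (here eq)) 2x≡0 (λ eq → x∉ (here eq)))))

    double-2-torsion : ∀ x → 2 * (2 * x) ≡ 0#
    double-2-torsion x = ≡.trans (*-assoc x 2 2) (4-torsion x)

    cyclicFour : CyclicFour
    cyclicFour with element
    ... | a , 2a≢0 = record { a = a ; 2a≢0 = 2a≢0 ; 4a≡0 = 4-torsion a ; all = all }
      where
      -- The only element of order 2 is 2a. If 2x ≠ 0 then 2x = 2a, so x - a is killed by 2 and
      -- equals 0 or 2a.
      all : ∀ x → x ∈ 0# ∷ a ∷ 2 * a ∷ 3 * a ∷ []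
      all x with x Finₚ.≟ 0# | 2 * x Finₚ.≟ 0# | x + (- a) Finₚ.≟ 0#
      ... | yes eq | _        | _ = here eq
      ... | no x≢0 | yes 2x≡0 | _ = there (there (here (klein 2x≡0 x≢0 (double-2-torsion a) 2a≢0)))
      ... | no _   | no 2x≢0  | yes eq = there (here (SA.combine eq
              (SA.solve 2 (λ x a → x :+ :0 ⊜ a :+ (x -′ a)) ≡.refl x a)))
      ... | no _   | no 2x≢0  | no x-a≢0 = there (there (there (here (SA.combine
              (klein {x + (- a)} {2 * a}
                (SA.combine (klein (double-2-torsion x) 2x≢0 (double-2-torsion a) 2a≢0)
                  (SA.solve 2 (λ x a → (2 ⊛ (x -′ a)) :+ (2 ⊛ a) ⊜ :0 :+ (2 ⊛ x)) ≡.refl x a))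
                x-a≢0 (double-2-torsion a) 2a≢0)
              (SA.solve 2 (λ x a → x :+ (2 ⊛ a) ⊜ (3 ⊛ a) :+ (x -′ a)) ≡.refl x a)))))

-- Integer sums and the lower bound 4 for squared norms.

module _ where
  open import Data.Integer using (_+_; _*_; -_; _-_; _≤_)
  open ℤSolver using (solve; _:+_; _:*_; _:-_; :-_; _:=_; con)
  open ≡ using (refl; sym; trans; cong; cong₂)

  -- Defined by recursion on both indices, so that sums against it reduce term by term.
  δ : ∀ {m} → Fin m → Fin m → ℤ
  δ zero    zero    = + 1
  δ zero    (suc j) = + 0
  δ (suc i) zero    = + 0
  δ (suc i) (suc j) = δ i j

  δ-refl : ∀ {m} (i : Fin m) → δ i i ≡ + 1
  δ-refl zero    = refl
  δ-refl (suc i) = δ-refl i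

  δ-≢ : ∀ {m} {i j : Fin m} → i ≢ j → δ i j ≡ + 0
  δ-≢ {i = zero}  {zero}  i≢j = contradiction refl i≢j
  δ-≢ {i = zero}  {suc j} i≢j = refl
  δ-≢ {i = suc i} {zero}  i≢j = refl
  δ-≢ {i = suc i} {suc j} i≢j = δ-≢ (λ eq → i≢j (cong suc eq))

  δ-inject₁ : ∀ {m} (i j : Fin m) → δ (inject₁ i) (inject₁ j) ≡ δ i j
  δ-inject₁ zero    zero    = refl
  δ-inject₁ zero    (suc j) = refl
  δ-inject₁ (suc i) zero    = refl
  δ-inject₁ (suc i) (suc j) = δ-inject₁ i j

  sum-cong : ∀ m {f g : Fin m → ℤ} → (∀ i → f i ≡ g i) → sumℤ m f ≡ sumℤ m g
  sum-cong zero    f≗g = refl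
  sum-cong (suc m) f≗g = cong₂ _+_ (f≗g zero) (sum-cong m (λ i → f≗g (suc i)))

  sum-+ : ∀ m (f g : Fin m → ℤ) → sumℤ m (λ i → f i + g i) ≡ sumℤ m f + sumℤ m g
  sum-+ zero    f g = refl
  sum-+ (suc m) f g = trans (cong (λ s → (f zero + g zero) + s) (sum-+ m (λ i → f (suc i)) (λ i → g (suc i))))
    (solve 4 (λ a b c d → (a :+ b) :+ (c :+ d) := (a :+ c) :+ (b :+ d)) refl
       (f zero) (g zero) (sumℤ m (λ i → f (suc i))) (sumℤ m (λ i → g (suc i))))

  sum-*ˡ : ∀ m k (f : Fin m → ℤ) → sumℤ m (λ i → k * f i) ≡ k * sumℤ m f
  sum-*ˡ zero    k f = sym (ℤₚ.*-zeroʳ k)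
  sum-*ˡ (suc m) k f = trans (cong (λ s → k * f zero + s) (sum-*ˡ m k (λ i → f (suc i)))) (sym (ℤₚ.*-distribˡ-+ k (f zero) (sumℤ m (λ i → f (suc i)))))

  sum-*ʳ : ∀ m k (f : Fin m → ℤ) → sumℤ m (λ i → f i * k) ≡ sumℤ m f * k
  sum-*ʳ m k f = trans (sum-cong m (λ i → ℤₚ.*-comm (f i) k)) (trans (sum-*ˡ m k f) (ℤₚ.*-comm k _))

  sum-neg : ∀ m (f : Fin m → ℤ) → sumℤ m (λ i → - f i) ≡ - sumℤ m f
  sum-neg zero    f = refl
  sum-neg (suc m) f = trans (cong (λ s → - f zero + s) (sum-neg m (λ i → f (suc i)))) (sym (ℤₚ.neg-distrib-+ (f zero) (sumℤ m (λ i → f (suc i)))))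

  sum-- : ∀ m (f g : Fin m → ℤ) → sumℤ m (λ i → f i - g i) ≡ sumℤ m f - sumℤ m g
  sum-- m f g = trans (sum-+ m f (λ i → - g i)) (cong (λ s → sumℤ m f + s) (sum-neg m g))

  sum-zero : ∀ m {f : Fin m → ℤ} → (∀ i → f i ≡ + 0) → sumℤ m f ≡ + 0
  sum-zero zero    f≗0 = refl
  sum-zero (suc m) f≗0 = cong₂ _+_ (f≗0 zero) (sum-zero m (λ i → f≗0 (suc i)))

  sum-last : ∀ m (f : Fin (suc m) → ℤ) → sumℤ (suc m) f ≡ sumℤ m (λ i → f (inject₁ i)) + f (fromℕ m)
  sum-last zero    f = ℤₚ.+-comm (f zero) (+ 0)
  sum-last (suc m) f = trans (cong (λ s → f zero + s) (sum-last m (λ i → f (suc i)))) (sym (ℤₚ.+-assoc (f zero) _ _))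

  sum-δ : ∀ m (p : Fin m) (f : Fin m → ℤ) → sumℤ m (λ t → δ p t * f t) ≡ f p
  sum-δ (suc m) zero    f = trans (cong₂ _+_ (ℤₚ.*-identityˡ (f zero)) (sum-zero m (λ _ → refl))) (ℤₚ.+-identityʳ _)
  sum-δ (suc m) (suc p) f = trans (ℤₚ.+-identityˡ _) (sum-δ m p (λ i → f (suc i)))

  δ-sym : ∀ {m} (i j : Fin m) → δ i j ≡ δ j i
  δ-sym zero    zero    = refl
  δ-sym zero    (suc j) = refl
  δ-sym (suc i) zero    = refl
  δ-sym (suc i) (suc j) = δ-sym i j

  sum-δ′ : ∀ m (t : Fin m) (f : Fin m → ℤ) → sumℤ m (λ p → f p * δ p t) ≡ f t
  sum-δ′ m t f = trans (sum-cong m (λ p → trans (ℤₚ.*-comm (f p) _) (cong (_* f p) (δ-sym p t)))) (sum-δ m t f)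

  square-≥0 : ∀ y → + 0 ≤ y * y
  square-≥0 (+ zero)   = ℤ.+≤+ z≤n
  square-≥0 (+ suc n)  = ℤ.+≤+ z≤n
  square-≥0 (-[1+ n ]) = ℤ.+≤+ z≤n

  square-≥1 : ∀ {y} → y ≢ + 0 → + 1 ≤ y * y
  square-≥1 {+ zero}   y≢0 = contradiction refl y≢0
  square-≥1 {+ suc n}  y≢0 = ℤ.+≤+ (s≤s z≤n)
  square-≥1 { -[1+ n ]} y≢0 = ℤ.+≤+ (s≤s z≤n)

  square-≥4 : ∀ {y} → y ≢ + 0 → y ≢ + 1 → y ≢ -[1+ 0 ] → + 4 ≤ y * y
  square-≥4 {+ zero}         y≢0 _ _  = contradiction refl y≢0
  square-≥4 {+ suc zero}     _ y≢1 _  = contradiction refl y≢1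
  square-≥4 {+ suc (suc n)}  _ _ _    = ℤ.+≤+ (ℕₚ.*-mono-≤ {2} {suc (suc n)} {2} {suc (suc n)} (s≤s (s≤s z≤n)) (s≤s (s≤s z≤n)))
  square-≥4 { -[1+ zero ]}   _ _ y≢-1 = contradiction refl y≢-1
  square-≥4 { -[1+ suc n ]}  _ _ _    = ℤ.+≤+ (ℕₚ.*-mono-≤ {2} {suc (suc n)} {2} {suc (suc n)} (s≤s (s≤s z≤n)) (s≤s (s≤s z≤n)))

  square-parityℕ : ∀ n → ∃[ h ] + n * + n ≡ + n + + 2 * h
  square-parityℕ zero = + 0 , refl
  square-parityℕ (suc n) with square-parityℕ n
  ... | h , eq = h + + n , trans
    (solve 1 (λ y → (con (+ 1) :+ y) :* (con (+ 1) :+ y) := (y :* y) :+ (con (+ 1) :+ (y :+ y))) refl (+ n))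
    (trans (cong (λ s → s + (+ 1 + (+ n + + n))) eq)
      (solve 2 (λ y h → (y :+ con (+ 2) :* h) :+ (con (+ 1) :+ (y :+ y)) := (con (+ 1) :+ y) :+ con (+ 2) :* (h :+ y)) refl (+ n) h))

  square-parity : ∀ y → ∃[ h ] y * y ≡ y + + 2 * h
  square-parity (+ n) = square-parityℕ n
  square-parity (-[1+ n ]) with square-parityℕ (suc n)
  ... | h , eq = h + + suc n , trans eq
    (solve 2 (λ y h → y :+ con (+ 2) :* h := :- y :+ con (+ 2) :* (h :+ y)) refl (+ suc n) h)

  normOf : ∀ m → (Fin m → ℤ) → ℤ
  normOf m f = sumℤ m (λ i → f i * f i)

  -- Each y² - y is even, so squared norm and coordinate sum have the same parity; on sum-zero
  -- vectors the squared norm is even.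
  norm-parity : ∀ m f → ∃[ h ] normOf m f ≡ sumℤ m f + + 2 * h
  norm-parity zero    f = + 0 , refl
  norm-parity (suc m) f with square-parity (f zero) | norm-parity m (λ i → f (suc i))
  ... | h , eq | h′ , eq′ = h + h′ , trans (cong₂ _+_ eq eq′)
    (solve 4 (λ y s h h′ → (y :+ con (+ 2) :* h) :+ (s :+ con (+ 2) :* h′) := (y :+ s) :+ con (+ 2) :* (h :+ h′)) refl (f zero) _ h h′)

  norm-≥0 : ∀ m f → + 0 ≤ normOf m f
  norm-≥0 zero    f = ℤ.+≤+ z≤n
  norm-≥0 (suc m) f = ℤₚ.+-mono-≤ (square-≥0 (f zero)) (norm-≥0 m (λ i → f (suc i)))

  norm-cong : ∀ m {f g} → (∀ i → f i ≡ g i) → normOf m f ≡ normOf m g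
  norm-cong m f≗g = sum-cong m (λ i → cong₂ _*_ (f≗g i) (f≗g i))

  zero-or-nonzero : ∀ m (f : Fin m → ℤ) → (∀ i → f i ≡ + 0) ⊎ ∃[ i ] f i ≢ + 0
  zero-or-nonzero m f with Finₚ.any? (λ i → ¬? (f i ℤ.≟ + 0))
  ... | yes found = inj₂ found
  ... | no ¬found = inj₁ λ i → decidable-stable (f i ℤ.≟ + 0) λ fi≢0 → ¬found (i , fi≢0)

  clear : ∀ {m} → Fin m → (Fin m → ℤ) → Fin m → ℤ
  clear i f t = f t - δ i t * f i

  clear-self : ∀ {m} (i : Fin m) f → clear i f i ≡ + 0
  clear-self i f = trans (cong (λ d → f i - d * f i) (δ-refl i))
    (solve 1 (λ y → y :- con (+ 1) :* y := con (+ 0)) refl (f i))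

  sum-clear : ∀ m i f → sumℤ m (clear i f) ≡ sumℤ m f - f i
  sum-clear m i f = trans (sum-- m f _) (cong (λ s → sumℤ m f - s) (sum-δ m i (λ _ → f i)))

  -- Pythagoras for the orthogonal summands f(i) e_i and `clear i f`.
  norm-clear : ∀ m i f → normOf m f ≡ f i * f i + normOf m (clear i f)
  norm-clear m i f = begin
    normOf m f
      ≡⟨ solve 2 (λ n y → n := y :+ ((n :- con (+ 2) :* y) :+ y)) refl (normOf m f) (f i * f i) ⟩
    f i * f i + ((normOf m f - + 2 * (f i * f i)) + f i * f i)
      ≡⟨ cong (λ s → f i * f i + s) (sym clear²) ⟩
    f i * f i + normOf m (clear i f) ∎
    where
    open ≡.≡-Reasoning
    clear² : normOf m (clear i f) ≡ (normOf m f - + 2 * (f i * f i)) + f i * f i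
    clear² = begin
      normOf m (clear i f)
        ≡⟨ sum-cong m (λ t → solve 3 (λ x d y → (x :- d :* y) :* (x :- d :* y)
              := ((x :* x) :- d :* (con (+ 2) :* (y :* x))) :+ d :* (d :* (y :* y))) refl (f t) (δ i t) (f i)) ⟩
      sumℤ m (λ t → (f t * f t - δ i t * (+ 2 * (f i * f t))) + δ i t * (δ i t * (f i * f i)))
        ≡⟨ sum-+ m _ _ ⟩
      sumℤ m (λ t → f t * f t - δ i t * (+ 2 * (f i * f t))) + sumℤ m (λ t → δ i t * (δ i t * (f i * f i)))
        ≡⟨ cong₂ _+_ (trans (sum-- m _ _) (cong (λ s → normOf m f - s) (sum-δ m i _))) (sum-δ m i _) ⟩
      (normOf m f - + 2 * (f i * f i)) + δ i i * (f i * f i)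
        ≡⟨ cong (λ d → (normOf m f - + 2 * (f i * f i)) + d) (trans (cong (_* (f i * f i)) (δ-refl i)) (ℤₚ.*-identityˡ _)) ⟩
      (normOf m f - + 2 * (f i * f i)) + f i * f i ∎

  -- Matching on this record replaces `clear i f` by a variable known only through these equations,
  -- which can then be peeled again.
  record Peeled (m : ℕ) (i : Fin m) (f : Fin m → ℤ) : Set where
    constructor peeled
    field
      rest      : Fin m → ℤ
      rest-self : rest i ≡ + 0
      rest-sum  : sumℤ m rest ≡ sumℤ m f - f i
      rest-norm : normOf m f ≡ f i * f i + normOf m rest
      split     : ∀ t → f t ≡ rest t + δ i t * f i

  peel : ∀ m i f → Peeled m i f
  peel m i f = peeled (clear i f) (clear-self i f) (sum-clear m i f) (norm-clear m i f)
    (λ t → solve 3 (λ x d y → x := (x :- d :* y) :+ d :* y) refl (f t) (δ i t) (f i))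

  even-≥4 : ∀ {x} h → x ≡ + 2 * h → + 3 ≤ x → + 4 ≤ x
  even-≥4 (+ 0)           refl (ℤ.+≤+ ())
  even-≥4 (+ 1)           refl (ℤ.+≤+ (s≤s (s≤s ())))
  even-≥4 (+ suc (suc h)) refl _ = ℤₚ.*-monoˡ-≤-nonNeg (+ 2) {+ 2} {+ suc (suc h)} (ℤ.+≤+ (s≤s (s≤s z≤n)))
  even-≥4 (-[1+ h ])      refl ()

  -- A sum-zero vector has even norm, so three nonzero coordinates already force norm at least 4.
  norm-≥4 : ∀ m f → sumℤ m f ≡ + 0 → (∃[ i ] f i ≢ + 0) →
            (∀ {i j} → i ≢ j → ¬ (∀ t → f t ≡ δ i t - δ j t)) → + 4 ≤ normOf m f
  norm-≥4 m f deg0 (i , fi≢0) not-root with peel m i f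
  ... | peeled f′ f′i≡0 sum′ norm′ split′ with zero-or-nonzero m f′
  -- With a single nonzero coordinate the sum could not vanish.
  ...   | inj₁ f′≗0 = contradiction (begin
            f i                  ≡⟨ solve 1 (λ y → y := :- (con (+ 0) :- y)) refl (f i) ⟩
            - (+ 0 - f i)        ≡⟨ cong (λ s → - (s - f i)) (sym deg0) ⟩
            - (sumℤ m f - f i)   ≡⟨ cong -_ (sym sum′) ⟩
            - sumℤ m f′          ≡⟨ cong -_ (sum-zero m f′≗0) ⟩
            + 0                  ∎) fi≢0
    where open ≡.≡-Reasoning
  ...   | inj₂ (j , f′j≢0) with peel m j f′
  ...     | peeled f″ _ sum″ norm″ split″ with zero-or-nonzero m f″
  ...       | inj₂ (k , f″k≢0) = even-≥4 (proj₁ parity)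
                (trans (proj₂ parity) (trans (cong (λ s → s + + 2 * proj₁ parity) deg0) (ℤₚ.+-identityˡ _))) three
    where
    parity = norm-parity m f
    three : + 3 ≤ normOf m f
    three with peel m k f″
    ... | peeled f‴ _ _ norm‴ _ = ≡.subst (+ 3 ≤_)
      (sym (trans norm′ (cong (λ s → f i * f i + s) (trans norm″ (cong (λ s → f′ j * f′ j + s) norm‴)))))
      (ℤₚ.+-mono-≤ (square-≥1 fi≢0) (ℤₚ.+-mono-≤ (square-≥1 f′j≢0)
        (ℤₚ.+-mono-≤ (square-≥1 f″k≢0) (norm-≥0 m f‴))))
  -- With exactly two nonzero coordinates f = f(i) (e_i - e_j). The coefficients 1 and -1 are
  -- excluded by hypothesis, and any other one has square at least 4.
  ...       | inj₁ f″≗0 = multiple (f i ℤ.≟ + 1) (f i ℤ.≟ -[1+ 0 ])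
    where
    open ≡.≡-Reasoning

    i≢j : i ≢ j
    i≢j refl = f′j≢0 f′i≡0

    f′j : f′ j ≡ - f i
    f′j = begin
      f′ j                              ≡⟨ solve 2 (λ s y → y := s :- (s :- y)) refl (sumℤ m f′) (f′ j) ⟩
      sumℤ m f′ - (sumℤ m f′ - f′ j)    ≡⟨ cong (λ s → sumℤ m f′ - s) (trans (sym sum″) (sum-zero m f″≗0)) ⟩
      sumℤ m f′ - + 0                   ≡⟨ cong (λ s → s - + 0) (trans sum′ (cong (λ s → s - f i) deg0)) ⟩
      (+ 0 - f i) - + 0                 ≡⟨ solve 1 (λ y → (con (+ 0) :- y) :- con (+ 0) := :- y) refl (f i) ⟩
      - f i                             ∎

    root : ∀ t → f t ≡ f i * (δ i t - δ j t)
    root t = begin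
      f t                                        ≡⟨ split′ t ⟩
      f′ t + δ i t * f i                         ≡⟨ cong (λ s → s + δ i t * f i) (split″ t) ⟩
      (f″ t + δ j t * f′ j) + δ i t * f i        ≡⟨ cong₂ (λ u w → (u + δ j t * w) + δ i t * f i) (f″≗0 t) f′j ⟩
      (+ 0 + δ j t * - f i) + δ i t * f i        ≡⟨ solve 3 (λ d e y → (con (+ 0) :+ e :* (:- y)) :+ d :* y := y :* (d :- e)) refl (δ i t) (δ j t) (f i) ⟩
      f i * (δ i t - δ j t)                      ∎

    multiple : Dec (f i ≡ + 1) → Dec (f i ≡ -[1+ 0 ]) → + 4 ≤ normOf m f
    multiple (yes eq) _ = contradiction
      (λ t → trans (root t) (trans (cong (λ y → y * (δ i t - δ j t)) eq) (ℤₚ.*-identityˡ _))) (not-root i≢j)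
    multiple (no _) (yes eq) = contradiction
      (λ t → trans (root t) (trans (cong (λ y → y * (δ i t - δ j t)) eq)
        (solve 2 (λ d e → con -[1+ 0 ] :* (d :- e) := e :- d) refl (δ i t) (δ j t)))) (not-root (λ j≡i → i≢j (sym j≡i)))
    multiple (no n₁) (no n₋₁) = ≡.subst (+ 4 ≤_) (sym norm′)
      (ℤₚ.+-mono-≤ (square-≥4 fi≢0 n₁ n₋₁) (norm-≥0 m f′))

-- The quotient of the integer vectors by a finitely generated subgroup.

module Quotient (m k : ℕ) (v : Fin k → Vecℤ m) where
  open import Data.Integer using (_+_; _*_; -_; _-_)
  open ℤSolver using (solve; _:+_; _:*_; _:-_; :-_; _:=_; con)
  open ≡ using (refl; sym; trans; cong; cong₂)

  infix 4 _~_
  -- The coefficients are kept as data, since the spanning statement asks for them. As a record it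
  -- lets both vectors be recovered by unification.
  record _~_ (X Y : Vecℤ m) : Set where
    constructor _via_
    field
      coefficients : Fin k → ℤ
      difference   : ∀ t → X t - Y t ≡ lincomb m k coefficients v t

  lincomb-+ : ∀ c d t → lincomb m k (λ j → c j + d j) v t ≡ lincomb m k c v t + lincomb m k d v t
  lincomb-+ c d t = trans (sum-cong k (λ j → ℤₚ.*-distribʳ-+ (v j t) (c j) (d j))) (sum-+ k _ _)

  lincomb-neg : ∀ c t → lincomb m k (λ j → - c j) v t ≡ - lincomb m k c v t
  lincomb-neg c t = trans (sum-cong k (λ j → sym (ℤₚ.neg-distribˡ-* (c j) (v j t)))) (sum-neg k _)

  ≗⇒~ : ∀ {X Y} → (∀ t → X t ≡ Y t) → X ~ Y
  ≗⇒~ {X} {Y} X≗Y = (λ _ → + 0) via λ t → trans (trans (cong (λ x → x - Y t) (X≗Y t)) (ℤₚ.+-inverseʳ (Y t)))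
    (sym (sum-zero k (λ j → refl)))

  ~-sym : ∀ {X Y} → X ~ Y → Y ~ X
  ~-sym {X} {Y} (c via eq) = (λ j → - c j) via λ t → trans
    (solve 2 (λ x y → y :- x := :- (x :- y)) refl (X t) (Y t)) (trans (cong -_ (eq t)) (sym (lincomb-neg c t)))

  ~-trans : ∀ {X Y Z} → X ~ Y → Y ~ Z → X ~ Z
  ~-trans {X} {Y} {Z} (c via eq) (d via eq′) = (λ j → c j + d j) via λ t → trans
    (solve 3 (λ x y z → x :- z := (x :- y) :+ (y :- z)) refl (X t) (Y t) (Z t))
    (trans (cong₂ _+_ (eq t) (eq′ t)) (sym (lincomb-+ c d t)))

  +-resp : ∀ {X X′ Y Y′} → X ~ X′ → Y ~ Y′ → (λ t → X t + Y t) ~ (λ t → X′ t + Y′ t)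
  +-resp {X} {X′} {Y} {Y′} (c via eq) (d via eq′) = (λ j → c j + d j) via λ t → trans
    (solve 4 (λ x x′ y y′ → (x :+ y) :- (x′ :+ y′) := (x :- x′) :+ (y :- y′)) refl (X t) (X′ t) (Y t) (Y′ t))
    (trans (cong₂ _+_ (eq t) (eq′ t)) (sym (lincomb-+ c d t)))

  neg-resp : ∀ {X Y} → X ~ Y → (λ t → - X t) ~ (λ t → - Y t)
  neg-resp {X} {Y} (c via eq) = (λ j → - c j) via λ t → trans
    (solve 2 (λ x y → (:- x) :- (:- y) := :- (x :- y)) refl (X t) (Y t)) (trans (cong -_ (eq t)) (sym (lincomb-neg c t)))

  v~0 : ∀ j → v j ~ (λ _ → + 0)
  v~0 j = δ j via λ t → trans (ℤₚ.+-identityʳ (v j t)) (sym (sum-δ k j (λ i → v i t)))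

  quotient : AbelianGroup 0ℓ 0ℓ
  quotient = record
    { Carrier = Vecℤ m ; _≈_ = _~_
    ; _∙_ = λ X Y t → X t + Y t ; ε = λ _ → + 0 ; _⁻¹ = λ X t → - X t
    ; isAbelianGroup = record
      { isGroup = record
        { isMonoid = record
          { isSemigroup = record
            { isMagma = record
              { isEquivalence = record { refl = ≗⇒~ (λ _ → refl) ; sym = ~-sym ; trans = ~-trans }
              ; ∙-cong = +-resp }
            ; assoc = λ X Y Z → ≗⇒~ (λ t → ℤₚ.+-assoc (X t) (Y t) (Z t)) }
          ; identity = (λ X → ≗⇒~ (λ t → ℤₚ.+-identityˡ (X t))) , (λ X → ≗⇒~ (λ t → ℤₚ.+-identityʳ (X t))) }
        ; inverse = (λ X → ≗⇒~ (λ t → ℤₚ.+-inverseˡ (X t))) , (λ X → ≗⇒~ (λ t → ℤₚ.+-inverseʳ (X t)))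
        ; ⁻¹-cong = neg-resp }
      ; comm = λ X Y → ≗⇒~ (λ t → ℤₚ.+-comm (X t) (Y t)) } }

-- The group structure carried over to coordinate indices.

module Indexing {c ℓ} (G : FinAbGroup c ℓ) where
  open FinAbGroup G hiding (_-_)
  open import Algebra.Properties.AbelianGroup grp using (inverseʳ-unique)

  -- The last index stands for the zero of G, so that coordinates of lattice vectors are labelled by
  -- the elements of G.
  enumerate : {i : Fin (suc n)} → Top.View i → Carrier
  enumerate Top.‵fromℕ           = ε
  enumerate (Top.‵inj₁ {i = i} _) = g i

  el : Fin (suc n) → Carrier
  el i = enumerate (Top.view i)

  el-fromℕ : el (fromℕ n) ≡ ε
  el-fromℕ = ≡.cong enumerate (Top.view-fromℕ n)

  el-inject₁ : ∀ i → el (inject₁ i) ≡ g i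
  el-inject₁ i = ≡.cong enumerate (Top.view-inject₁ i)

  el-injective : ∀ i j → el i ≈ el j → i ≡ j
  el-injective i j eq with Top.view i | Top.view j
  ... | Top.‵fromℕ           | Top.‵fromℕ           = ≡.refl
  ... | Top.‵fromℕ           | Top.‵inj₁ {i = j} _ = contradiction (sym eq) (g-nonzero j)
  ... | Top.‵inj₁ {i = i} _ | Top.‵fromℕ           = contradiction eq (g-nonzero i)
  ... | Top.‵inj₁ {i = i} _ | Top.‵inj₁ {i = j} _ = ≡.cong inject₁ (g-injective i j eq)

  index-nonzero : ∀ x → ¬ (x ≈ ε) → ∃[ i ] el i ≈ x
  index-nonzero x x≉ε with g-surjective x x≉ε
  ... | i , gi≈x = inject₁ i , trans (reflexive (el-inject₁ i)) gi≈x

  0# : Fin (suc n)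
  0# = fromℕ n

  -- Abstract, so that sums of indices do not unfold into the case analyses that compute them.
  abstract
    index-neg : ∀ i → ∃[ j ] el j ≈ el i ⁻¹
    index-neg i with i Finₚ.≟ 0#
    ... | yes ≡.refl = 0# , inverseʳ-unique (el 0#) (el 0#)
                        (trans (∙-cong (reflexive el-fromℕ) (reflexive el-fromℕ)) (identityˡ ε))
    ... | no i≢0 = index-nonzero _ λ eq → i≢0 (el-injective i 0# (trans (sym (identityʳ _))
                        (trans (∙-congˡ (sym eq)) (trans (inverseʳ _) (reflexive (≡.sym el-fromℕ))))))

    -- Whether the sum is zero cannot be tested in G, but it is zero exactly when `j` is the index
    -- of the inverse, and indices can be compared.
    index-∙ : ∀ i j → ∃[ k ] el k ≈ el i ∙ el j
    index-∙ i j with index-neg i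
    ... | i⁻ , eq with j Finₚ.≟ i⁻
    ...   | yes ≡.refl = 0# , trans (reflexive el-fromℕ) (sym (trans (∙-congˡ eq) (inverseʳ _)))
    ...   | no j≢i⁻ = index-nonzero _ λ sum≈ε → j≢i⁻ (el-injective j i⁻
                        (trans (inverseʳ-unique (el i) (el j) sum≈ε) (sym eq)))

  _+_ : Fin (suc n) → Fin (suc n) → Fin (suc n)
  i + j = proj₁ (index-∙ i j)

  -_ : Fin (suc n) → Fin (suc n)
  - i = proj₁ (index-neg i)

  el-+ : ∀ i j → el (i + j) ≈ el i ∙ el j
  el-+ i j = proj₂ (index-∙ i j)

  el-neg : ∀ i → el (- i) ≈ el i ⁻¹
  el-neg i = proj₂ (index-neg i)

  el-0 : el 0# ≈ ε
  el-0 = reflexive el-fromℕ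

  isAbelianGroup-index : IsAbelianGroup _≡_ _+_ 0# -_
  isAbelianGroup-index = record
    { isGroup = record
      { isMonoid = record
        { isSemigroup = record
          { isMagma = record { isEquivalence = ≡.isEquivalence ; ∙-cong = ≡.cong₂ _+_ }
          ; assoc = λ i j k → el-injective _ _ (trans (el-+ (i + j) k) (trans (∙-congʳ (el-+ i j))
              (trans (assoc _ _ _) (sym (trans (el-+ i (j + k)) (∙-congˡ (el-+ j k))))))) }
        ; identity = (λ i → el-injective _ _ (trans (el-+ 0# i) (trans (∙-congʳ el-0) (identityˡ _))))
                   , (λ i → el-injective _ _ (trans (el-+ i 0#) (trans (∙-congˡ el-0) (identityʳ _)))) }
      ; inverse = (λ i → el-injective _ _ (trans (el-+ (- i) i) (trans (∙-congʳ (el-neg i)) (trans (inverseˡ _) (sym el-0)))))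
                , (λ i → el-injective _ _ (trans (el-+ i (- i)) (trans (∙-congˡ (el-neg i)) (trans (inverseʳ _) (sym el-0)))))
      ; ⁻¹-cong = ≡.cong -_ }
    ; comm = λ i j → el-injective _ _ (trans (el-+ i j) (trans (comm _ _) (sym (el-+ j i)))) }

-- The lattice: minimal vectors from relations, and spanning.

module Lattice {c ℓ} (G : FinAbGroup c ℓ) where
  open FinAbGroup G
  open Indexing G using (el; el-fromℕ; el-inject₁; el-injective; el-+; el-neg; el-0; isAbelianGroup-index)
  module I = Indexing G
  open FiniteGroup I._+_ I.0# I.-_ isAbelianGroup-index public hiding (assoc; comm; identityˡ; identityʳ; inverseˡ; inverseʳ)
  open IntegerMultiples grp
  open import Algebra.Properties.AbelianGroup grp using (ε⁻¹≈ε; x∙y⁻¹≈ε⇒x≈y)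

  0# : A
  0# = I.0#

  el-* : ∀ k i → el (k * i) ≈ k ×ℕ el i
  el-* zero    i = el-0
  el-* (suc k) i = trans (el-+ i (k * i)) (∙-congˡ (el-* k i))

  ·ℕ≡×ℕ : ∀ k x → k ·ℕ x ≡ k ×ℕ x
  ·ℕ≡×ℕ zero    x = ≡.refl
  ·ℕ≡×ℕ (suc k) x = ≡.cong (x ∙_) (·ℕ≡×ℕ k x)

  ·≡⊙ : ∀ k x → k · x ≡ k ⊙ x
  ·≡⊙ (+ k)      x = ·ℕ≡×ℕ k x
  ·≡⊙ (-[1+ k ]) x = ≡.cong _⁻¹ (·ℕ≡×ℕ (suc k) x)

  ·-+ : ∀ x i j → (i ℤ.+ j) · x ≈ i · x ∙ j · x
  ·-+ x i j = trans (reflexive (·≡⊙ (i ℤ.+ j) x)) (trans (⊙-homo-+ x i j)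
    (sym (∙-cong (reflexive (·≡⊙ i x)) (reflexive (·≡⊙ j x)))))

  ·-neg : ∀ x i → (ℤ.- i) · x ≈ (i · x) ⁻¹
  ·-neg x i = trans (reflexive (·≡⊙ (ℤ.- i) x)) (trans (⊙-homo-neg x i) (⁻¹-cong (sym (reflexive (·≡⊙ i x)))))

  gsum-cong : ∀ m {f h : Fin m → Carrier} → (∀ i → f i ≈ h i) → gsum m f ≈ gsum m h
  gsum-cong zero    f≈h = refl
  gsum-cong (suc m) f≈h = ∙-cong (f≈h zero) (gsum-cong m (λ i → f≈h (suc i)))

  gsum-∙ : ∀ m (f h : Fin m → Carrier) → gsum m (λ i → f i ∙ h i) ≈ gsum m f ∙ gsum m h
  gsum-∙ zero    f h = sym (identityˡ ε)
  gsum-∙ (suc m) f h = trans (∙-congˡ (gsum-∙ m _ _)) (interchange _ _ _ _)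

  gsum-⁻¹ : ∀ m (f : Fin m → Carrier) → gsum m (λ i → f i ⁻¹) ≈ gsum m f ⁻¹
  gsum-⁻¹ zero    f = sym ε⁻¹≈ε
  gsum-⁻¹ (suc m) f = trans (∙-congˡ (gsum-⁻¹ m _)) (sym (⁻¹-homo-∙ _ _))

  gsum-ε : ∀ m {f : Fin m → Carrier} → (∀ i → f i ≈ ε) → gsum m f ≈ ε
  gsum-ε zero    f≈ε = refl
  gsum-ε (suc m) f≈ε = trans (∙-cong (f≈ε zero) (gsum-ε m (λ i → f≈ε (suc i)))) (identityˡ ε)

  gsum-δ : ∀ m p (f : Fin m → Carrier) → gsum m (λ i → δ p i · f i) ≈ f p
  gsum-δ (suc m) zero    f = trans (∙-cong (identityʳ _) (gsum-ε m (λ _ → refl))) (identityʳ _)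
  gsum-δ (suc m) (suc p) f = trans (identityˡ _) (gsum-δ m p (λ i → f (suc i)))

  -- The homomorphism to G that sends each unit vector to the element labelling it; the last
  -- coordinate, labelled by zero, contributes nothing.
  val : Vecℤ n → Carrier
  val X = gsum n (λ i → X (inject₁ i) · g i)

  val-cong : ∀ {X Y} → (∀ t → X t ≡ Y t) → val X ≈ val Y
  val-cong X≗Y = gsum-cong n (λ i → reflexive (≡.cong (_· g i) (X≗Y (inject₁ i))))

  val-+ : ∀ X Y → val (λ t → X t ℤ.+ Y t) ≈ val X ∙ val Y
  val-+ X Y = trans (gsum-cong n (λ i → ·-+ (g i) (X (inject₁ i)) (Y (inject₁ i)))) (gsum-∙ n _ _)

  val-- : ∀ X Y → val (λ t → X t ℤ.- Y t) ≈ val X ∙ val Y ⁻¹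
  val-- X Y = trans (val-+ X (λ t → ℤ.- Y t))
    (∙-congˡ (trans (gsum-cong n (λ i → ·-neg (g i) (Y (inject₁ i)))) (gsum-⁻¹ n _)))

  val-δ : ∀ p → val (δ p) ≈ el p
  val-δ p with Top.view p
  ... | Top.‵fromℕ = gsum-ε n (λ i → reflexive (≡.cong (_· g i) (δ-≢ (Finₚ.fromℕ≢inject₁ {i = i}))))
  ... | Top.‵inj₁ {i = p} _ = trans (gsum-cong n (λ i → reflexive (≡.cong (_· g i) (δ-inject₁ p i)))) (gsum-δ n p g)

  InL⇒sum≡0 : ∀ X → InL G X → sumℤ (suc n) X ≡ + 0
  InL⇒sum≡0 X (last , _) = ≡.trans (sum-last n X)
    (≡.trans (≡.cong (λ x → sumℤ n (λ i → X (inject₁ i)) ℤ.+ x) last) (ℤₚ.+-inverseʳ (sumℤ n (λ i → X (inject₁ i)))))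

  inL : ∀ X → sumℤ (suc n) X ≡ + 0 → val X ≈ ε → InL G X
  inL X sum≡0 val≈ε = ≡.trans (≡.sym (ℤₚ.+-identityˡ _))
    (≡.trans (≡.cong (ℤ._+ X (fromℕ n)) (≡.sym (ℤₚ.+-inverseˡ init)))
    (≡.trans (ℤₚ.+-assoc (ℤ.- init) init _)
    (≡.trans (≡.cong (λ x → ℤ.- init ℤ.+ x) (≡.trans (≡.sym (sum-last n X)) sum≡0)) (ℤₚ.+-identityʳ _)))) , val≈ε
    where init = sumℤ n (λ i → X (inject₁ i))

  -- A lattice vector e_i - e_j has value `el i` minus `el j`, which is zero only for i = j; so the
  -- exceptional case of `norm-≥4` does not occur.
  norm-≥4-InL : ∀ Y → InL G Y → ¬ IsZero n Y → + 4 ℤ.≤ normSq n Y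
  norm-≥4-InL Y Y∈L Y≢0 with zero-or-nonzero (suc n) Y
  ... | inj₁ Y≗0   = contradiction Y≗0 Y≢0
  ... | inj₂ found = norm-≥4 (suc n) Y (InL⇒sum≡0 Y Y∈L) found λ {i} {j} i≢j Y≗ → i≢j (el-injective i j
          (x∙y⁻¹≈ε⇒x≈y _ _ (trans (sym (trans (val-cong Y≗) (trans (val-- (δ i) (δ j)) (∙-cong (val-δ i) (⁻¹-cong (val-δ j))))))
            (proj₂ Y∈L))))

  -- The map φ; its nonzero values are roots of the lattice A_n of sum-zero integer vectors.
  root : A → Vecℤ n
  root p t = δ p t ℤ.- δ 0# t

  vec : Quad → Vecℤ n
  vec ⟨ p , q ∣ r , s ⟩ t = (δ p t ℤ.+ δ q t) ℤ.- (δ r t ℤ.+ δ s t)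

  -- For f = `vec Q` this computes the squared norm, for f = 1 the coordinate sum.
  sum-vec : ∀ Q (f : A → ℤ) → sumℤ (suc n) (λ t → vec Q t ℤ.* f t) ≡ (f (Quad.p Q) ℤ.+ f (Quad.q Q)) ℤ.- (f (Quad.r Q) ℤ.+ f (Quad.s Q))
  sum-vec ⟨ p , q ∣ r , s ⟩ f = ≡.trans
    (sum-cong (suc n) (λ t → solve 5 (λ p q r s x → ((p :+ q) :- (r :+ s)) :* x := ((p :* x) :+ (q :* x)) :- ((r :* x) :+ (s :* x)))
       ≡.refl (δ p t) (δ q t) (δ r t) (δ s t) (f t)))
    (≡.trans (sum-- (suc n) (λ t → δ p t ℤ.* f t ℤ.+ δ q t ℤ.* f t) (λ t → δ r t ℤ.* f t ℤ.+ δ s t ℤ.* f t)) (≡.cong₂ ℤ._-_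
      (≡.trans (sum-+ (suc n) (λ t → δ p t ℤ.* f t) (λ t → δ q t ℤ.* f t)) (≡.cong₂ ℤ._+_ (sum-δ (suc n) p f) (sum-δ (suc n) q f)))
      (≡.trans (sum-+ (suc n) (λ t → δ r t ℤ.* f t) (λ t → δ s t ℤ.* f t)) (≡.cong₂ ℤ._+_ (sum-δ (suc n) r f) (sum-δ (suc n) s f)))))
    where open ℤSolver using (solve; _:+_; _:*_; _:-_; _:=_)

  vec∈S : ∀ {Q} → Proper Q → InS G (vec Q)
  vec∈S {Q@(⟨ p , q ∣ r , s ⟩)} P = inL (vec Q) sum≡0 val≈ε , nonzero ,
    λ Y Y∈L Y≢0 → ≡.subst (ℤ._≤ normSq n Y) (≡.sym norm≡4) (norm-≥4-InL Y Y∈L Y≢0)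
    where
    open Proper P
    q≢r : q ≢ r
    q≢r ≡.refl = p≢s (SA.combine balanced (SA.solve 3 (λ p q s → p SA.:+ (q SA.:+ s) SA.⊜ s SA.:+ (p SA.:+ q)) ≡.refl p q s))
    q≢s : q ≢ s
    q≢s ≡.refl = p≢r (SA.combine balanced (SA.solve 3 (λ p q r → p SA.:+ (r SA.:+ q) SA.⊜ r SA.:+ (p SA.:+ q)) ≡.refl p q r))

    entry : ∀ {a b c d t} → δ p t ≡ a → δ q t ≡ b → δ r t ≡ c → δ s t ≡ d → vec Q t ≡ (a ℤ.+ b) ℤ.- (c ℤ.+ d)
    entry ≡.refl ≡.refl ≡.refl ≡.refl = ≡.refl

    at-p : vec Q p ≡ + 1
    at-p = entry (δ-refl p) (δ-≢ (p≢q ∘ ≡.sym)) (δ-≢ (p≢r ∘ ≡.sym)) (δ-≢ (p≢s ∘ ≡.sym))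
    at-q : vec Q q ≡ + 1
    at-q = entry (δ-≢ p≢q) (δ-refl q) (δ-≢ (q≢r ∘ ≡.sym)) (δ-≢ (q≢s ∘ ≡.sym))
    at-r : vec Q r ≡ -[1+ 0 ]
    at-r = entry (δ-≢ p≢r) (δ-≢ q≢r) (δ-refl r) (δ-≢ (r≢s ∘ ≡.sym))
    at-s : vec Q s ≡ -[1+ 0 ]
    at-s = entry (δ-≢ p≢s) (δ-≢ q≢s) (δ-≢ r≢s) (δ-refl s)

    norm≡4 : normSq n (vec Q) ≡ + 4
    norm≡4 = ≡.trans (sum-vec Q (vec Q)) (≡.cong₂ ℤ._-_ (≡.cong₂ ℤ._+_ at-p at-q) (≡.cong₂ ℤ._+_ at-r at-s))

    nonzero : ¬ IsZero n (vec Q)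
    nonzero vec≗0 with ≡.trans (≡.sym at-p) (vec≗0 p)
    ... | ()

    sum≡0 : sumℤ (suc n) (vec Q) ≡ + 0
    sum≡0 = ≡.trans (sum-cong (suc n) (λ t → ≡.sym (ℤₚ.*-identityʳ (vec Q t)))) (sum-vec Q (λ _ → + 1))

    val-δδ : ∀ i j → val (λ t → δ i t ℤ.+ δ j t) ≈ el (i I.+ j)
    val-δδ i j = trans (val-+ (δ i) (δ j)) (trans (∙-cong (val-δ i) (val-δ j)) (sym (el-+ i j)))

    val≈ε : val (vec Q) ≈ ε
    val≈ε = trans (val-- (λ t → δ p t ℤ.+ δ q t) (λ t → δ r t ℤ.+ δ s t))
      (trans (∙-cong (val-δδ p q) (⁻¹-cong (val-δδ r s)))
        (trans (∙-congʳ (reflexive (≡.cong el balanced))) (inverseʳ _)))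

  module Spanning {k : ℕ} (v : Fin k → Vecℤ n) where
    open Quotient n k v

    module _ (additive : ∀ i j → root (i I.+ j) ~ (λ t → root i t ℤ.+ root j t)) where
      open import Algebra.Properties.AbelianGroup quotient using () renaming (inverseʳ-unique to ~-inverseʳ-unique)

      root0~0 : root 0# ~ (λ _ → + 0)
      root0~0 = ≗⇒~ (λ t → ℤₚ.+-inverseʳ (δ 0# t))

      -- The graph of the additive map from G to the quotient induced by φ. It is a relation because
      -- no index can be computed from an arbitrary element of G.
      Represents : Carrier → Vecℤ n → Set ℓ
      Represents x Z = ∃[ a ] el a ≈ x × root a ~ Z

      represents-ε : Represents ε (λ _ → + 0)
      represents-ε = 0# , el-0 , root0~0

      represents-∙ : ∀ {x y X Y} → Represents x X → Represents y Y → Represents (x ∙ y) (λ t → X t ℤ.+ Y t)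
      represents-∙ (a , a≈x , a~X) (b , b≈y , b~Y) =
        (a I.+ b) , trans (el-+ a b) (∙-cong a≈x b≈y) , ~-trans (additive a b) (+-resp a~X b~Y)

      represents-⁻¹ : ∀ {x X} → Represents x X → Represents (x ⁻¹) (λ t → ℤ.- X t)
      represents-⁻¹ (a , a≈x , a~X) = (I.- a) , trans (el-neg a) (⁻¹-cong a≈x) ,
        ~-trans (~-inverseʳ-unique (root a) (root (I.- a)) (~-trans (~-sym (additive a (I.- a)))
          (~-trans (≗⇒~ (λ t → ≡.cong (λ i → root i t) (AbelianGroup.inverseʳ 𝔸 a))) root0~0))) (neg-resp a~X)

      represents-≗ : ∀ {x X Y} → (∀ t → X t ≡ Y t) → Represents x X → Represents x Y
      represents-≗ X≗Y (a , a≈x , a~X) = a , a≈x , ~-trans a~X (≗⇒~ X≗Y)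

      represents-·ℕ : ∀ m {x X} → Represents x X → Represents (m ·ℕ x) (λ t → + m ℤ.* X t)
      represents-·ℕ zero    R = represents-≗ (λ t → ≡.refl) represents-ε
      represents-·ℕ (suc m) {X = X} R = represents-≗ (λ t → ≡.sym (ℤₚ.suc-* (+ m) (X t))) (represents-∙ R (represents-·ℕ m R))

      represents-· : ∀ m {x X} → Represents x X → Represents (m · x) (λ t → m ℤ.* X t)
      represents-· (+ m)      R = represents-·ℕ m R
      represents-· (-[1+ m ]) {X = X} R = represents-≗ (λ t → ℤₚ.neg-distribˡ-* (+ suc m) (X t)) (represents-⁻¹ (represents-·ℕ (suc m) R))

      -- The reindexing `f` serves the induction, which removes the first index; it is used with the
      -- identity.
      represents-gsum : ∀ m (f : Fin m → Fin n) (x : Fin m → ℤ) →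
        Represents (gsum m (λ i → x i · g (f i))) (λ t → sumℤ m (λ i → x i ℤ.* root (inject₁ (f i)) t))
      represents-gsum zero    f x = represents-ε
      represents-gsum (suc m) f x = represents-∙
        (represents-· (x zero) (inject₁ (f zero) , reflexive (el-inject₁ (f zero)) , ≗⇒~ (λ _ → ≡.refl)))
        (represents-gsum m (λ i → f (suc i)) (λ i → x (suc i)))

      -- A sum-zero vector is the combination of the φ(g) with its own coordinates, hence is
      -- equivalent to φ of its value. For a lattice vector the value is zero, and φ(0) = 0.
      span : ∀ X → InL G X → ∃[ c ] (∀ i → X i ≡ lincomb n k c v i)
      span X X∈L with represents-gsum n (λ i → i) (λ i → X (inject₁ i))
      ... | a , a≈ , a~Z with el-injective a 0# (trans a≈ (trans (proj₂ X∈L) (sym el-0)))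
      ...   | ≡.refl with ~-trans (≗⇒~ X≗Z) (~-trans (~-sym a~Z) root0~0)
        where
        open ≡.≡-Reasoning
        X≗Z : ∀ t → X t ≡ sumℤ n (λ i → X (inject₁ i) ℤ.* root (inject₁ i) t)
        X≗Z t = ≡.sym (begin
          sumℤ n (λ i → X (inject₁ i) ℤ.* root (inject₁ i) t)
            ≡⟨ sum-cong n (λ i → solve 3 (λ x d e → x :* (d :- e) := x :* d :- x :* e) ≡.refl (X (inject₁ i)) (δ (inject₁ i) t) (δ 0# t)) ⟩
          sumℤ n (λ i → X (inject₁ i) ℤ.* δ (inject₁ i) t ℤ.- X (inject₁ i) ℤ.* δ 0# t)
            ≡⟨ ≡.trans (sum-- n (λ i → X (inject₁ i) ℤ.* δ (inject₁ i) t) (λ i → X (inject₁ i) ℤ.* δ 0# t))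
                 (≡.cong (λ u → sumℤ n (λ i → X (inject₁ i) ℤ.* δ (inject₁ i) t) ℤ.- u) (sum-*ʳ n (δ 0# t) (λ i → X (inject₁ i)))) ⟩
          sumℤ n (λ i → X (inject₁ i) ℤ.* δ (inject₁ i) t) ℤ.- sumℤ n (λ i → X (inject₁ i)) ℤ.* δ 0# t
            -- The last coordinate is added and taken away again, so that both sums run over all
            -- indices.
            ≡⟨ solve 4 (λ s u d l → s :- u :* d := (s :+ l :* d) :- (u :+ l) :* d) ≡.refl
                 (sumℤ n (λ i → X (inject₁ i) ℤ.* δ (inject₁ i) t)) (sumℤ n (λ i → X (inject₁ i))) (δ 0# t) (X 0#) ⟩
          (sumℤ n (λ i → X (inject₁ i) ℤ.* δ (inject₁ i) t) ℤ.+ X 0# ℤ.* δ 0# t) ℤ.- (sumℤ n (λ i → X (inject₁ i)) ℤ.+ X 0#) ℤ.* δ 0# t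
            ≡⟨ ≡.cong₂ (λ u w → u ℤ.- w ℤ.* δ 0# t)
                 (≡.trans (≡.sym (sum-last n (λ i → X i ℤ.* δ i t))) (sum-δ′ (suc n) t X))
                 (≡.trans (≡.sym (sum-last n X)) (InL⇒sum≡0 X X∈L)) ⟩
          X t ℤ.- + 0 ℤ.* δ 0# t
            ≡⟨ solve 2 (λ x d → x :- con (+ 0) :* d := x) ≡.refl (X t) (δ 0# t) ⟩
          X t ∎)
          where open ℤSolver using (solve; _:+_; _:*_; _:-_; _:=_; con)
      ...     | c via eq = c , λ t → ≡.trans (≡.sym (ℤₚ.+-identityʳ (X t))) (eq t)

  -- Keeping `m` variable allows matching on the length equation, which is then used at the fixed
  -- number n.
  listed : ∀ {b} {B : Set b} (xs : List B) {m} → length xs ≡ m →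
           Σ (Fin m → B) λ f → (∀ j → f j ∈ xs) × (∀ {x} → x ∈ xs → ∃[ j ] f j ≡ x)
  listed xs ≡.refl = lookup xs , ∈-lookup , λ x∈ → index x∈ , ≡.sym (Anyₚ.lookup-index x∈)

  -- A full stage has n + 1 elements, hence n relations. Its additivity clause is applied to the
  -- quotient by the span of its own relation vectors, where each relation is killed because its
  -- vector is a generator.
  stage⇒basis : (T : Stage) → (∀ x → x ∈ Stage.D T) → HasMinimalBasis G
  stage⇒basis T full with listed (Stage.quads T) (ℕₚ.suc-injective (≡.trans (Stage.size T)
      (ℕₚ.≤-antisym (unique-length≤ (Submonoid.unique (Stage.submonoid T)))
        (≡.subst (ℕ._≤ length (Stage.D T)) (Listₚ.length-tabulate (λ i → i))
          (unique-⊆⇒length-≤ (Uniqueₚ.allFin⁺ (suc n)) (λ {x} _ → full x))))))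
  ... | quad , quad∈ , index-of =
    v , (λ j → vec∈S (Stage.proper T (quad∈ j)))
      , Spanning.span v λ i j → Stage.additive T quotient root (≗⇒~ (λ t → ℤₚ.+-inverseʳ (δ 0# t)))
          kill (full i) (full j)
    where
    v : Fin n → Vecℤ n
    v j = vec (quad j)
    open Quotient n n v
    open ℤSolver using (solve; _:+_; _:-_; _:=_; con)

    kill : ∀ {Q} → Q ∈ Stage.quads T → Kills quotient root Q
    kill Q∈ with index-of Q∈
    kill {⟨ p , q ∣ r , s ⟩} Q∈ | j , eq with v~0 j
    ... | c via v≗ = c via λ t → ≡.trans
      (solve 5 (λ p q r s z → ((p :- z) :+ (q :- z)) :- ((r :- z) :+ (s :- z)) := ((p :+ q) :- (r :+ s)) :- con (+ 0))
        ≡.refl (δ p t) (δ q t) (δ r t) (δ s t) (δ 0# t))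
      (≡.trans (≡.cong (λ Q → vec Q t ℤ.- + 0) (≡.sym eq)) (v≗ t))

-- Recognising ℤ₄ without decidable equality.

module CyclicFourIso {c ℓ} (G : FinAbGroup c ℓ) where
  open FinAbGroup G
  open Lattice G
  open Indexing G using (el; el-injective; el-+; el-neg; el-0; index-nonzero)
  private module SG = AbelianGroupSolver grp

  open import Relation.Binary.Reasoning.Setoid setoid

  isoZ4 : CyclicFour → IsoZ4 G
  isoZ4 C = f , f-homo , f-injective , f-surjective
    where
    open CyclicFour C

    order : IsRelativeOrder (0# ∷ []) a 4
    order = record
      { positive = s≤s z≤n
      ; ka∈      = here 4a≡0
      ; minimal  = λ
        { {1} _ _ (here eq) → 2a≢0 (≡.trans (≡.cong (a I.+_) eq) (≡.trans (𝔸.identityʳ a) (≡.trans (≡.sym (𝔸.identityʳ a)) eq)))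
        ; {2} _ _ (here eq) → 2a≢0 eq
        -- From 2a = 2 (4a) - 2 (3a).
        ; {3} _ _ (here eq) → 2a≢0 (SA.combine ((4a≡0 ⊞ 4a≡0) ⊞ (≡.sym eq ⊞ ≡.sym eq))
            (SA.solve 1 (λ a → (2 ⊛ a) SA.:+ ((SA.:0 SA.:+ SA.:0) SA.:+ ((3 ⊛ a) SA.:+ (3 ⊛ a)))
              SA.⊜ SA.:0 SA.:+ (((4 ⊛ a) SA.:+ (4 ⊛ a)) SA.:+ (SA.:0 SA.:+ SA.:0))) ≡.refl a))
        ; {suc (suc (suc (suc _)))} _ (s≤s (s≤s (s≤s (s≤s ())))) } }
      where module 𝔸 = AbelianGroup 𝔸

    f : Fin 4 → Carrier
    f j = el (toℕ j * a)

    multiple-of-zero : ∀ q → q * 0# ≡ 0#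
    multiple-of-zero zero    = ≡.refl
    multiple-of-zero (suc q) = ≡.trans (AbelianGroup.identityˡ 𝔸 _) (multiple-of-zero q)

    4*-vanishes : ∀ q → (q ℕ.* 4) * a ≡ 0#
    4*-vanishes q = ≡.trans (≡.sym (*-assoc a q 4)) (≡.trans (≡.cong (q *_) 4a≡0) (multiple-of-zero q))

    %4-* : ∀ m → (m % 4) * a ≡ m * a
    %4-* m = ≡.sym (≡.trans (≡.cong (_* a) (m≡m%n+[m/n]*n m 4)) (≡.trans (*-homo-+ a (m % 4) (m / 4 ℕ.* 4))
      (≡.trans (≡.cong (((m % 4) * a) I.+_) (4*-vanishes (m / 4))) (AbelianGroup.identityʳ 𝔸 _))))

    f-homo : ∀ x y → f (x +₄ y) ≈ f x ∙ f y
    f-homo x y = trans (reflexive (≡.cong el (≡.trans (≡.cong (_* a) (Finₚ.toℕ-fromℕ< (m%n<n (toℕ x ℕ.+ toℕ y) 4)))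
      (≡.trans (%4-* (toℕ x ℕ.+ toℕ y)) (*-homo-+ a (toℕ x) (toℕ y)))))) (el-+ _ _)

    f-injective : ∀ x y → f x ≈ f y → x ≡ y
    f-injective x y eq = Finₚ.toℕ-injective (≡.cong proj₂
      (Extension.point-injective trivial a order {0#} {0#} {toℕ x} {toℕ y} (here ≡.refl) (here ≡.refl)
        (Finₚ.toℕ<n x) (Finₚ.toℕ<n y) (≡.cong (0# I.+_) (el-injective _ _ eq))))

    multiple : ∀ i → ∃[ j ] toℕ {4} j * a ≡ i
    multiple i with all i
    ... | here ≡.refl                         = zero , ≡.refl
    ... | there (here ≡.refl)                 = suc zero , AbelianGroup.identityʳ 𝔸 a
    ... | there (there (here ≡.refl))         = suc (suc zero) , ≡.refl
    ... | there (there (there (here ≡.refl))) = suc (suc (suc zero)) , ≡.refl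

    4-torsion : ∀ i → 4 * i ≡ 0#
    4-torsion i with multiple i
    ... | j , ≡.refl = ≡.trans (*-assoc a 4 (toℕ j)) (≡.trans (≡.cong (_* a) (ℕₚ.*-comm 4 (toℕ j))) (4*-vanishes (toℕ j)))

    -- Doubling 2i + a = 0 gives 4i + 2a = 0, and 4i = 0 leaves 2a = 0.
    2i+a≢0 : ∀ i → (i I.+ i) I.+ a ≢ 0#
    2i+a≢0 i eq = 2a≢0 (SA.combine ((eq ⊞ eq) ⊞ ≡.sym (4-torsion i))
      (SA.solve 2 (λ i a → (2 ⊛ a) SA.:+ ((SA.:0 SA.:+ SA.:0) SA.:+ (4 ⊛ i))
        SA.⊜ SA.:0 SA.:+ ((((i SA.:+ i) SA.:+ a) SA.:+ ((i SA.:+ i) SA.:+ a)) SA.:+ SA.:0)) ≡.refl i a))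

    -- An element without an index would be nonzero, and nonzero elements have one. This suffices
    -- for negative conclusions such as `2x+a≉ε`.
    not-not-indexed : ∀ x → ¬ ¬ (∃[ i ] el i ≈ x)
    not-not-indexed x ¬i = ¬i (index-nonzero x λ x≈ε → ¬i (0# , trans el-0 (sym x≈ε)))

    2x+a≉ε : ∀ x → ¬ ((x ∙ x) ∙ el a ≈ ε)
    2x+a≉ε x y≈ε = not-not-indexed x λ { (i , i≈x) → 2i+a≢0 i (el-injective _ _ (begin
      el ((i I.+ i) I.+ a)  ≈⟨ el-+ (i I.+ i) a ⟩
      el (i I.+ i) ∙ el a   ≈⟨ ∙-congʳ (el-+ i i) ⟩
      (el i ∙ el i) ∙ el a  ≈⟨ ∙-congʳ (∙-cong i≈x i≈x) ⟩
      (x ∙ x) ∙ el a        ≈⟨ y≈ε ⟩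
      ε                     ≈⟨ el-0 ⟨
      el 0#                 ∎)) }

    el-2a≉ε : ¬ (el a ∙ el a ≈ ε)
    el-2a≉ε eq = 2a≢0 (el-injective _ _ (begin
      el (2 * a)      ≈⟨ el-+ a (1 * a) ⟩
      el a ∙ el (1 * a) ≡⟨ ≡.cong (λ i → el a ∙ el i) (AbelianGroup.identityʳ 𝔸 a) ⟩
      el a ∙ el a     ≈⟨ eq ⟩
      ε               ≈⟨ el-0 ⟨
      el 0#           ∎))

    -- The second hypothesis says 2x = 0, so x = -α would give 2α = 0.
    x+a≉ε : ∀ {x α} → ¬ (α ∙ α ≈ ε) → (x ∙ x) ∙ α ≈ α → ¬ (x ∙ α ≈ ε)
    x+a≉ε {x} {α} 2α≉ε 2x+α≈α x+α≈ε = 2α≉ε (SG.combine (∙-cong (∙-cong x+α≈ε x+α≈ε) (sym 2x+α≈α))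
      (SG.solve 2 (λ x a → (a SG.:+ a) SG.:+ ((SG.:0 SG.:+ SG.:0) SG.:+ ((x SG.:+ x) SG.:+ a))
        SG.⊜ SG.:0 SG.:+ (((x SG.:+ a) SG.:+ (x SG.:+ a)) SG.:+ a)) refl x α))

    -- Equality in G need not be decidable, but 2x + a is never zero, so g-surjective always
    -- applies to it, and its index tells enough about x to find a nonzero translate of x.
    indexed : ∀ x → ∃[ i ] el i ≈ x
    indexed x = decide (index-nonzero ((x ∙ x) ∙ el a) (2x+a≉ε x))
      where
      translate : (∃[ j ] el j ≈ x ∙ el a) → ∃[ i ] el i ≈ x
      translate (j , j≈) = (j I.+ (I.- a)) , (begin
        el (j I.+ (I.- a))          ≈⟨ el-+ j (I.- a) ⟩
        el j ∙ el (I.- a)           ≈⟨ ∙-cong j≈ (el-neg a) ⟩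
        (x ∙ el a) ∙ el a ⁻¹        ≈⟨ SG.solve 2 (λ x a → (x SG.:+ a) SG.:+ (SG.:- a) SG.⊜ x) refl x (el a) ⟩
        x                           ∎)

      decide : (∃[ i ] el i ≈ (x ∙ x) ∙ el a) → ∃[ i ] el i ≈ x
      decide (i , i≈y) with i Finₚ.≟ a
      -- Here 2x = 0, so x + a is nonzero and has an index, from which `a` is subtracted again.
      ... | yes i≡a = translate (index-nonzero (x ∙ el a)
                        (x+a≉ε el-2a≉ε (trans (sym i≈y) (reflexive (≡.cong el i≡a)))))
      ... | no i≢a  = index-nonzero x λ x≈ε → i≢a (el-injective i a (trans i≈y (trans (∙-congʳ (∙-cong x≈ε x≈ε))
                        (SG.solve 1 (λ a → (SG.:0 SG.:+ SG.:0) SG.:+ a SG.⊜ a) refl (el a)))))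

    f-surjective : ∀ x → ∃[ j ] f j ≈ x
    f-surjective x =
      let i , i≈x = indexed x ; j , eq = multiple i in j , trans (reflexive (≡.cong el eq)) i≈x

-- Groups of order 1, 2 and 3.

norm-≥1 : ∀ m f → ¬ (∀ i → f i ≡ + 0) → + 1 ℤ.≤ normOf m f
norm-≥1 m f f≢0 with zero-or-nonzero m f
... | inj₁ f≗0       = contradiction f≗0 f≢0
... | inj₂ (i , fi≢0) = ≡.subst (+ 1 ℤ.≤_) (≡.sym (norm-clear m i f))
      (ℤₚ.+-mono-≤ (square-≥1 fi≢0) (norm-≥0 m (clear i f)))

-- Applied to squared norms that are 8 or 6 times an integral quadratic form, where being positive
-- already means being at least 8 or 6.
multiple-≥ : ∀ k {x} y → x ≡ + suc k ℤ.* y → + 1 ℤ.≤ x → + suc k ℤ.≤ x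
multiple-≥ k (+ zero)   ≡.refl 1≤x with ≡.subst (+ 1 ℤ.≤_) (ℤₚ.*-zeroʳ (+ suc k)) 1≤x
... | ℤ.+≤+ ()
multiple-≥ k (+ suc y)  ≡.refl _ = ≡.subst (ℤ._≤ + suc k ℤ.* + suc y) (ℤₚ.*-identityʳ (+ suc k))
  (ℤₚ.*-monoˡ-≤-nonNeg (+ suc k) {+ 1} {+ suc y} (ℤ.+≤+ (s≤s z≤n)))
multiple-≥ k (-[1+ y ]) ≡.refl ()

basis-order-1 : ∀ {c ℓ} (G : FinAbGroup c ℓ) → FinAbGroup.n G ≡ 0 → HasMinimalBasis G
basis-order-1 record { n = zero }  _ = (λ ()) , (λ ()) , λ { X (last , _) → (λ ()) , λ { zero → last } }
basis-order-1 record { n = suc _ } ()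

-- The fields of the group are separate parameters, so that n is the literal 1 and indices can be
-- matched on.
module OrderTwo {c ℓ} (grp : AbelianGroup c ℓ) (g : Fin 1 → AbelianGroup.Carrier grp)
    (g-nonzero : ∀ i → ¬ AbelianGroup._≈_ grp (g i) (AbelianGroup.ε grp))
    (g-injective : ∀ i j → AbelianGroup._≈_ grp (g i) (g j) → i ≡ j)
    (g-surjective : ∀ x → ¬ AbelianGroup._≈_ grp x (AbelianGroup.ε grp) →
                    ∃[ i ] (AbelianGroup._≈_ grp (g i) x)) where

  open AbelianGroup grp
  G : FinAbGroup c ℓ
  G = record { grp = grp ; n = 1 ; g = g ; g-nonzero = g-nonzero ; g-injective = g-injective ; g-surjective = g-surjective }

  open Lattice G
  open Indexing G using (el; el-0)
  private module 𝔸 = AbelianGroup 𝔸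

  a : A
  a = zero

  2a≡0 : 2 * a ≡ 0#
  2a≡0 = cases _ ≡.refl
    where
    cases : ∀ x → 2 * a ≡ x → x ≡ 0#
    cases (suc zero) _  = ≡.refl
    cases zero       2a = contradiction {A = a ≡ 0#} (SA.combine 2a
      (SA.solve 1 (λ a → a SA.:+ a SA.⊜ SA.:0 SA.:+ (2 ⊛ a)) ≡.refl a)) (λ ())

  O : IsRelativeOrder (0# ∷ []) a 2
  O = relativeOrder-2 (λ { (here ()) }) (here 2a≡0)

  open Cyclic a O

  -- For order 2 the lattice consists of the vectors (x, -x) with x even.
  w : Vecℤ 1
  w zero       = + 2
  w (suc zero) = -[1+ 1 ]

  v : Fin 1 → Vecℤ 1
  v _ = w

  open Quotient 1 1 v

  w∈L : InL G w
  w∈L = inL w ≡.refl (trans (identityʳ _) (trans (sym (el-* 2 a)) (trans (reflexive (≡.cong el 2a≡0)) el-0)))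

  full : ∀ x → x ∈ E.D⁺
  full = unique-full (Submonoid.unique E.submonoid) length-D⁺

  span : ∀ X → InL G X → ∃[ c ] (∀ i → X i ≡ lincomb 1 1 c v i)
  span = Spanning.span v λ i j → cyclic-additive quotient root (≗⇒~ (λ t → ℤₚ.+-inverseʳ (δ 0# t)))
    (λ { {0} _ → ≗⇒~ (λ t → ℤₚ.+-inverseʳ (δ 0# t))
       ; {1} _ → ≗⇒~ (λ t → ≡.trans (≡.cong (λ x → root x t) (𝔸.identityʳ a)) (≡.sym (ℤₚ.+-identityʳ (root a t))))
       ; {suc (suc _)} (s≤s (s≤s ())) })
    -- Here 2 φ(a) = (2, -2) = w.
    ((λ _ → + 1) via λ { zero → ≡.refl ; (suc zero) → ≡.refl })
    (full i) (full j)

  norm-≥8 : ∀ Y → ¬ IsZero 1 Y → (∃[ c ] (∀ i → Y i ≡ lincomb 1 1 c v i)) → + 8 ℤ.≤ normSq 1 Y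
  norm-≥8 Y Y≢0 (c , Y≗) = multiple-≥ 7 (c zero ℤ.* c zero)
    (≡.trans (norm-cong 2 Y≗) (solve 1 (λ c →
        (c :* con (+ 2) :+ con (+ 0)) :* (c :* con (+ 2) :+ con (+ 0))
          :+ ((c :* con -[1+ 1 ] :+ con (+ 0)) :* (c :* con -[1+ 1 ] :+ con (+ 0)) :+ con (+ 0))
        := con (+ 8) :* (c :* c)) ≡.refl (c zero)))
    (norm-≥1 2 Y Y≢0)
    where open ℤSolver using (solve; _:+_; _:*_; _:=_; con)

  basis : HasMinimalBasis G
  basis = v , (λ j → w∈L , (λ w≗0 → contradiction (w≗0 zero) λ ()) , λ Y Y∈L Y≢0 → norm-≥8 Y Y≢0 (span Y Y∈L)) , span

module OrderThree {c ℓ} (grp : AbelianGroup c ℓ) (g : Fin 2 → AbelianGroup.Carrier grp)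
    (g-nonzero : ∀ i → ¬ AbelianGroup._≈_ grp (g i) (AbelianGroup.ε grp))
    (g-injective : ∀ i j → AbelianGroup._≈_ grp (g i) (g j) → i ≡ j)
    (g-surjective : ∀ x → ¬ AbelianGroup._≈_ grp x (AbelianGroup.ε grp) →
                    ∃[ i ] (AbelianGroup._≈_ grp (g i) x)) where

  open AbelianGroup grp
  G : FinAbGroup c ℓ
  G = record { grp = grp ; n = 2 ; g = g ; g-nonzero = g-nonzero ; g-injective = g-injective ; g-surjective = g-surjective }

  open Lattice G
  open Indexing G using (el; el-0)
  private
    module 𝔸 = AbelianGroup 𝔸
    module SG = AbelianGroupSolver grp

  a : A
  a = zero

  a+1≡0 : a I.+ suc zero ≡ 0#
  a+1≡0 = cases _ ≡.refl
    where
    cases : ∀ x → a I.+ suc zero ≡ x → x ≡ 0#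
    cases (suc (suc zero)) _ = ≡.refl
    cases zero       a+1 = contradiction {A = suc zero ≡ 0#} (SA.combine a+1
      (SA.solve 2 (λ a x → x SA.:+ a SA.⊜ SA.:0 SA.:+ (a SA.:+ x)) ≡.refl a (suc zero))) (λ ())
    cases (suc zero) a+1 = contradiction {A = a ≡ 0#} (SA.combine a+1
      (SA.solve 2 (λ a x → a SA.:+ x SA.⊜ SA.:0 SA.:+ (a SA.:+ x)) ≡.refl a (suc zero))) (λ ())

  2a≡1 : 2 * a ≡ suc zero
  2a≡1 = cases _ ≡.refl
    where
    cases : ∀ x → 2 * a ≡ x → x ≡ suc zero
    cases (suc zero)       _  = ≡.refl
    cases zero             2a = contradiction {A = a ≡ 0#} (SA.combine 2a
      (SA.solve 1 (λ a → a SA.:+ a SA.⊜ SA.:0 SA.:+ (2 ⊛ a)) ≡.refl a)) (λ ())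
    cases (suc (suc zero)) 2a = contradiction {A = a ≡ suc zero} (SA.combine (2a ⊞ ≡.sym a+1≡0)
      (SA.solve 3 (λ a x z → a SA.:+ (z SA.:+ (a SA.:+ x)) SA.⊜ x SA.:+ ((2 ⊛ a) SA.:+ z)) ≡.refl a (suc zero) 0#)) (λ ())

  3a≡0 : 3 * a ≡ 0#
  3a≡0 = ≡.trans (≡.cong (a I.+_) 2a≡1) a+1≡0

  O : IsRelativeOrder (0# ∷ []) a 3
  O = relativeOrder-3 (λ { (here ()) }) (λ { (here eq) → contradiction (≡.trans (≡.sym 2a≡1) eq) λ () }) (here 3a≡0)

  open Cyclic a O

  -- Two of the three permutations of (1, 1, -2); the third is minus their sum. The coordinates
  -- belong to a, 2a and 0.
  v : Fin 2 → Vecℤ 2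
  v zero       zero             = + 1
  v zero       (suc zero)       = + 1
  v zero       (suc (suc zero)) = -[1+ 1 ]
  v (suc zero) zero             = + 1
  v (suc zero) (suc zero)       = -[1+ 1 ]
  v (suc zero) (suc (suc zero)) = + 1

  open Quotient 2 2 v

  g₁≈2g₀ : g (suc zero) ≈ g zero ∙ (g zero ∙ ε)
  g₁≈2g₀ = trans (reflexive (≡.cong el (≡.sym 2a≡1))) (el-* 2 a)

  3g₀≈ε : g zero ∙ (g zero ∙ (g zero ∙ ε)) ≈ ε
  3g₀≈ε = trans (sym (el-* 3 a)) (trans (reflexive (≡.cong el 3a≡0)) el-0)

  v∈L : ∀ j → InL G (v j)
  v∈L zero = inL (v zero) ≡.refl (SG.combine (∙-cong g₁≈2g₀ 3g₀≈ε)
    (SG.solve 2 (λ x y → ((x SG.:+ SG.:0) SG.:+ ((y SG.:+ SG.:0) SG.:+ SG.:0)) SG.:+ ((x SG.:+ (x SG.:+ SG.:0)) SG.:+ SG.:0)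
      SG.⊜ SG.:0 SG.:+ (y SG.:+ (x SG.:+ (x SG.:+ (x SG.:+ SG.:0))))) refl (g zero) (g (suc zero))))
  v∈L (suc zero) = inL (v (suc zero)) ≡.refl (SG.combine (∙-cong (sym (∙-cong g₁≈2g₀ g₁≈2g₀)) (sym 3g₀≈ε))
    (SG.solve 2 (λ x y →
        ((x SG.:+ SG.:0) SG.:+ ((SG.:- (y SG.:+ (y SG.:+ SG.:0))) SG.:+ SG.:0))
          SG.:+ ((y SG.:+ y) SG.:+ (x SG.:+ (x SG.:+ (x SG.:+ SG.:0))))
      SG.⊜ SG.:0 SG.:+ (((x SG.:+ (x SG.:+ SG.:0)) SG.:+ (x SG.:+ (x SG.:+ SG.:0))) SG.:+ SG.:0))
      refl (g zero) (g (suc zero))))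

  full : ∀ x → x ∈ E.D⁺
  full = unique-full (Submonoid.unique E.submonoid) length-D⁺

  span : ∀ X → InL G X → ∃[ c ] (∀ i → X i ≡ lincomb 2 2 c v i)
  span = Spanning.span v λ i j → cyclic-additive quotient root (≗⇒~ (λ t → ℤₚ.+-inverseʳ (δ 0# t)))
    (λ { {0} _ → ≗⇒~ (λ t → ℤₚ.+-inverseʳ (δ 0# t))
       ; {1} _ → ≗⇒~ (λ t → ≡.trans (≡.cong (λ x → root x t) (𝔸.identityʳ a)) (≡.sym (ℤₚ.+-identityʳ (root a t))))
       ; {2} _ → ~-trans (≗⇒~ (λ t → ≡.cong (λ x → root x t) 2a≡1))
           -- Here φ(2a) - 2 φ(a) = (-2, 1, 1), which is minus the sum of the two vectors.
           ((λ _ → -[1+ 0 ]) via λ { zero → ≡.refl ; (suc zero) → ≡.refl ; (suc (suc zero)) → ≡.refl })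
       ; {suc (suc (suc _))} (s≤s (s≤s (s≤s ()))) })
    -- Here 3 φ(a) = (3, 0, -3), twice the first vector plus the second.
    ((λ { zero → + 2 ; (suc zero) → + 1 }) via λ { zero → ≡.refl ; (suc zero) → ≡.refl ; (suc (suc zero)) → ≡.refl })
    (full i) (full j)

  norm-v : ∀ j → normSq 2 (v j) ≡ + 6
  norm-v zero       = ≡.refl
  norm-v (suc zero) = ≡.refl

  -- In the coordinates c₀, c₁ the squared norm is 6 (c₀² - c₀c₁ + c₁²), six times the norm form of
  -- the Eisenstein integers: the lattice is a scaled hexagonal lattice.
  norm-≥6 : ∀ Y → ¬ IsZero 2 Y → (∃[ c ] (∀ i → Y i ≡ lincomb 2 2 c v i)) → + 6 ℤ.≤ normSq 2 Y
  norm-≥6 Y Y≢0 (c , Y≗) = multiple-≥ 5 (c₀ ℤ.* c₀ ℤ.- c₀ ℤ.* c₁ ℤ.+ c₁ ℤ.* c₁)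
    (≡.trans (norm-cong 3 Y≗) (solve 2 (λ c₀ c₁ →
        sq (c₀ :* con (+ 1) :+ (c₁ :* con (+ 1) :+ con (+ 0)))
          :+ (sq (c₀ :* con (+ 1) :+ (c₁ :* con -[1+ 1 ] :+ con (+ 0)))
          :+ (sq (c₀ :* con -[1+ 1 ] :+ (c₁ :* con (+ 1) :+ con (+ 0))) :+ con (+ 0)))
        := con (+ 6) :* ((c₀ :* c₀ :- c₀ :* c₁) :+ c₁ :* c₁)) ≡.refl c₀ c₁))
    (norm-≥1 3 Y Y≢0)
    where
    open ℤSolver using (Polynomial; solve; _:+_; _:*_; _:-_; _:=_; con)
    c₀ c₁ : ℤ
    c₀ = c zero
    c₁ = c (suc zero)
    sq : ∀ {m} → Polynomial m → Polynomial m
    sq x = x :* x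

  basis : HasMinimalBasis G
  basis = v , (λ j → v∈L j , v≢0 j , λ Y Y∈L Y≢0 → ≡.subst (ℤ._≤ normSq 2 Y) (≡.sym (norm-v j)) (norm-≥6 Y Y≢0 (span Y Y∈L))) , span
    where
    v≢0 : ∀ j → ¬ IsZero 2 (v j)
    v≢0 zero       v≗0 = contradiction (v≗0 zero) λ ()
    v≢0 (suc zero) v≗0 = contradiction (v≗0 zero) λ ()

-- Conclusion by the order of the group.

basis-order-≥4 : ∀ {c ℓ} (G : FinAbGroup c ℓ) → 3 ℕ.≤ FinAbGroup.n G → ¬ IsoZ4 G → HasMinimalBasis G
basis-order-≥4 G 3≤n ¬Z4 with Lattice.stage-or-cyclicFour G (s≤s 3≤n)
... | inj₁ (T , full) = Lattice.stage⇒basis G T full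
... | inj₂ C          = contradiction (CyclicFourIso.isoZ4 G C) ¬Z4

theorem1p3 : ∀ {c ℓ : Level} (G : FinAbGroup c ℓ) → ¬ IsoZ4 G → HasMinimalBasis G
theorem1p3 G@record { n = 0 } _ = basis-order-1 G ≡.refl
theorem1p3 record { grp = grp ; n = 1 ; g = g ; g-nonzero = nz ; g-injective = inj ; g-surjective = surj } _ =
  OrderTwo.basis grp g nz inj surj
theorem1p3 record { grp = grp ; n = 2 ; g = g ; g-nonzero = nz ; g-injective = inj ; g-surjective = surj } _ =
  OrderThree.basis grp g nz inj surj
theorem1p3 G@record { n = suc (suc (suc n)) } ¬Z4 = basis-order-≥4 G (s≤s (s≤s (s≤s z≤n))) ¬Z4
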